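{- There exist two bi-regular (in fact $3$-regular) bipartite graphs $G$ and $G'$ that have the same spectrum, the same degree sequences and the same girth $g=6$, but have different numbers of $i$-cycles for $i\ge 2g$ (that is, for cycles of length $2g=12$ and larger). Consequently, in general, it is not possible to determine the number of $i$-cycles, $i\ge 2g$, in a bi-regular bipartite graph of girth $g$ as a function of only the spectrum and the degree sequences of the graph.
   Context: All graphs are undirected and simple (no loops or parallel edges). The spectrum of a graph is the collection of eigenvalues of its adjacency matrix (with multiplicity). The degree sequences of a bipartite graph are the two monotonic non-increasing sequences of the node degrees on the two sides of the bipartition. A bipartite graph is bi-regular if all nodes on the same side of the bipartition have the same degree. An $i$-cycle is a cycle of length $i$. The girth $g$ of a graph is the length of its shortest cycle(s). All cycles of a bipartite graph have even length, so cycle lengths $i$ are understood to be even. -}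

module Defs where

open import Algebra.Bundles using (RawRing)
import Algebra.Definitions.RawMonoid as Sum
open import Data.Bool.Base using (Bool; true; false; T; if_then_else_)
open import Data.Bool.Properties using (T?) renaming (_≟_ to _≟ᵇ_)
open import Data.Empty using (⊥)
open import Data.Fin.Base as Fin using (Fin)
import Data.Fin.Properties as Fin
open import Data.List.Base
  using (List; []; _∷_; [_]; _++_; map; filter; length; head; last; allFin; cartesianProductWith)
open import Data.List.Relation.Unary.All using (All; all?)
open import Data.List.Relation.Unary.Linked using (Linked; linked?)
open import Data.List.Relation.Unary.Unique.Propositional using (Unique)
import Data.List.Relation.Unary.Unique.DecPropositional as DecUnique
import Data.List.Sort as Sort
open import Data.Maybe.Relation.Binary.Connected using (Connected; connected?)
open import Data.Nat.Base as ℕ using (ℕ; zero; suc)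
import Data.Nat.Properties as ℕ
open import Data.Product.Base using (Σ-syntax; ∃-syntax; _×_; _,_)
open import Data.Rational.Base as ℚ using (ℚ; 0ℚ; 1ℚ; ½)
import Data.Rational.Properties as ℚ
open import Data.Rational.Solver using (module +-*-Solver)
open import Data.Vec.Functional using (Vector)
open import Level using (0ℓ)
open import Relation.Binary.Construct.Flip.EqAndOrd using () renaming (decTotalOrder to flipOrder)
open import Relation.Binary.PropositionalEquality using (_≡_; _≢_; refl; cong; cong₂; sym; subst; module ≡-Reasoning)
open import Relation.Nullary.Decidable.Core using (no; _×-dec_)
open import Relation.Unary using (Decidable)

-- Cauchy sequences of rationals, compared up to null
-- sequences.  Since arbitrary Cauchy sequences are allowed, the ring
-- operations are pointwise.

record ℝ : Set where
  constructor mkℝ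
  field
    seq    : ℕ → ℚ
    cauchy : ∀ ε → 0ℚ ℚ.< ε →
             ∃[ N ] ∀ m n → N ℕ.≤ m → N ℕ.≤ n → ℚ.∣ seq m ℚ.- seq n ∣ ℚ.< ε

open ℝ public

infix 4 _≈ᴿ_
infixl 6 _+ᴿ_
infixl 7 _*ᴿ_

_≈ᴿ_ : ℝ → ℝ → Set
x ≈ᴿ y = ∀ ε → 0ℚ ℚ.< ε →
         ∃[ N ] ∀ n → N ℕ.≤ n → ℚ.∣ seq x n ℚ.- seq y n ∣ ℚ.< ε

fromℚ : ℚ → ℝ
fromℚ q .seq _ = q
fromℚ q .cauchy ε 0<ε =
  0 , λ _ _ _ _ → subst (λ z → ℚ.∣ z ∣ ℚ.< ε) (sym (ℚ.+-inverseʳ q)) 0<ε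

0ᴿ 1ᴿ : ℝ
0ᴿ = fromℚ 0ℚ
1ᴿ = fromℚ 1ℚ

module CauchyLemmas where
  *-pos : ∀ p q → 0ℚ ℚ.< p → 0ℚ ℚ.< q → 0ℚ ℚ.< p ℚ.* q
  *-pos p q 0<p 0<q =
    subst (ℚ._< p ℚ.* q) (ℚ.*-zeroʳ p) (ℚ.*-monoʳ-<-pos p {{ℚ.positive 0<p}} 0<q)

  halves : ∀ ε → ½ ℚ.* ε ℚ.+ ½ ℚ.* ε ≡ ε
  halves ε = begin
    ½ ℚ.* ε ℚ.+ ½ ℚ.* ε  ≡⟨ ℚ.*-distribʳ-+ ε ½ ½ ⟨
    1ℚ ℚ.* ε             ≡⟨ ℚ.*-identityˡ ε ⟩
    ε                    ∎
    where open ≡-Reasoning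

  half-pos : ∀ {ε} → 0ℚ ℚ.< ε → 0ℚ ℚ.< ½ ℚ.* ε
  half-pos {ε} = *-pos ½ ε (ℚ.positive⁻¹ ½)

  -- For K > 0 and ε > 0, a δ > 0 with K δ = ε.
  divide : ∀ K ε → 0ℚ ℚ.< K → 0ℚ ℚ.< ε → Σ[ δ ∈ ℚ ] (0ℚ ℚ.< δ × K ℚ.* δ ≡ ε)
  divide K ε 0<K 0<ε = K⁻¹ ℚ.* ε , *-pos K⁻¹ ε 0<K⁻¹ 0<ε , eq
    where
    instance
      K-pos = ℚ.positive 0<K
      K-nonZero = ℚ.pos⇒nonZero K
    K⁻¹ = ℚ.1/ K
    0<K⁻¹ : 0ℚ ℚ.< K⁻¹
    0<K⁻¹ = ℚ.positive⁻¹ K⁻¹ {{ℚ.1/pos⇒pos K}}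
    open ≡-Reasoning
    eq : K ℚ.* (K⁻¹ ℚ.* ε) ≡ ε
    eq = begin
      K ℚ.* (K⁻¹ ℚ.* ε)  ≡⟨ ℚ.*-assoc K K⁻¹ ε ⟨
      K ℚ.* K⁻¹ ℚ.* ε    ≡⟨ cong (ℚ._* ε) (ℚ.*-inverseʳ K) ⟩
      1ℚ ℚ.* ε           ≡⟨ ℚ.*-identityˡ ε ⟩
      ε                  ∎

  eventuallyBounded : (x : ℝ) →
    Σ[ K ∈ ℚ ] (0ℚ ℚ.< K × ∃[ N ] ∀ n → N ℕ.≤ n → ℚ.∣ seq x n ∣ ℚ.≤ K)
  eventuallyBounded x with cauchy x 1ℚ (ℚ.positive⁻¹ 1ℚ)
  ... | N , close = K , 0<K , N , bound
    where
    open ℚ.≤-Reasoning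
    K = 1ℚ ℚ.+ ℚ.∣ seq x N ∣
    0<K : 0ℚ ℚ.< K
    0<K = ℚ.+-mono-<-≤ (ℚ.positive⁻¹ 1ℚ) (ℚ.0≤∣p∣ (seq x N))
    split : ∀ a b → a ≡ (a ℚ.- b) ℚ.+ b
    split = solve 2 (λ a b → a := (a :- b) :+ b) refl
      where open +-*-Solver
    bound : ∀ n → N ℕ.≤ n → ℚ.∣ seq x n ∣ ℚ.≤ K
    bound n N≤n = begin
      ℚ.∣ seq x n ∣
        ≡⟨ cong ℚ.∣_∣ (split (seq x n) (seq x N)) ⟩
      ℚ.∣ (seq x n ℚ.- seq x N) ℚ.+ seq x N ∣
        ≤⟨ ℚ.∣p+q∣≤∣p∣+∣q∣ (seq x n ℚ.- seq x N) (seq x N) ⟩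
      ℚ.∣ seq x n ℚ.- seq x N ∣ ℚ.+ ℚ.∣ seq x N ∣
        ≤⟨ ℚ.+-monoˡ-≤ ℚ.∣ seq x N ∣ (ℚ.<⇒≤ (close n N N≤n ℕ.≤-refl)) ⟩
      K ∎

open CauchyLemmas

_+ᴿ_ : ℝ → ℝ → ℝ
(x +ᴿ y) .seq n = seq x n ℚ.+ seq y n
(x +ᴿ y) .cauchy ε 0<ε
  with cauchy x (½ ℚ.* ε) (half-pos 0<ε) | cauchy y (½ ℚ.* ε) (half-pos 0<ε)
... | N₁ , c₁ | N₂ , c₂ = N₁ ℕ.⊔ N₂ , close
  where
  open ℚ.≤-Reasoning
  rearrange : ∀ a b c d → (a ℚ.+ b) ℚ.- (c ℚ.+ d) ≡ (a ℚ.- c) ℚ.+ (b ℚ.- d)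
  rearrange = solve 4 (λ a b c d → (a :+ b) :- (c :+ d) := (a :- c) :+ (b :- d)) refl
    where open +-*-Solver
  close : ∀ m n → N₁ ℕ.⊔ N₂ ℕ.≤ m → N₁ ℕ.⊔ N₂ ℕ.≤ n →
          ℚ.∣ (seq x m ℚ.+ seq y m) ℚ.- (seq x n ℚ.+ seq y n) ∣ ℚ.< ε
  close m n N≤m N≤n = begin-strict
    ℚ.∣ (seq x m ℚ.+ seq y m) ℚ.- (seq x n ℚ.+ seq y n) ∣
      ≡⟨ cong ℚ.∣_∣ (rearrange (seq x m) (seq y m) (seq x n) (seq y n)) ⟩
    ℚ.∣ (seq x m ℚ.- seq x n) ℚ.+ (seq y m ℚ.- seq y n) ∣
      ≤⟨ ℚ.∣p+q∣≤∣p∣+∣q∣ (seq x m ℚ.- seq x n) (seq y m ℚ.- seq y n) ⟩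
    ℚ.∣ seq x m ℚ.- seq x n ∣ ℚ.+ ℚ.∣ seq y m ℚ.- seq y n ∣
      <⟨ ℚ.+-mono-< (c₁ m n (ℕ.m⊔n≤o⇒m≤o N₁ N₂ N≤m) (ℕ.m⊔n≤o⇒m≤o N₁ N₂ N≤n))
                    (c₂ m n (ℕ.m⊔n≤o⇒n≤o N₁ N₂ N≤m) (ℕ.m⊔n≤o⇒n≤o N₁ N₂ N≤n)) ⟩
    ½ ℚ.* ε ℚ.+ ½ ℚ.* ε
      ≡⟨ halves ε ⟩
    ε ∎

-ᴿ_ : ℝ → ℝ
(-ᴿ x) .seq n = ℚ.- seq x n
(-ᴿ x) .cauchy ε 0<ε with cauchy x ε 0<ε
... | N , c = N , λ m n N≤m N≤n →
  subst (ℚ._< ε) (swap (seq x m) (seq x n)) (c m n N≤m N≤n)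
  where
  neg : ∀ a b → ℚ.- (a ℚ.- b) ≡ (ℚ.- a) ℚ.- (ℚ.- b)
  neg = solve 2 (λ a b → :- (a :- b) := (:- a) :- (:- b)) refl
    where open +-*-Solver
  swap : ∀ a b → ℚ.∣ a ℚ.- b ∣ ≡ ℚ.∣ (ℚ.- a) ℚ.- (ℚ.- b) ∣
  swap a b = begin
    ℚ.∣ a ℚ.- b ∣              ≡⟨ ℚ.∣-p∣≡∣p∣ (a ℚ.- b) ⟨
    ℚ.∣ ℚ.- (a ℚ.- b) ∣        ≡⟨ cong ℚ.∣_∣ (neg a b) ⟩
    ℚ.∣ (ℚ.- a) ℚ.- (ℚ.- b) ∣  ∎
    where open ≡-Reasoning

module ProductLemmas where
  *-rearrange : ∀ a b c d → a ℚ.* b ℚ.- c ℚ.* d ≡ a ℚ.* (b ℚ.- d) ℚ.+ d ℚ.* (a ℚ.- c)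
  *-rearrange = solve 4 (λ a b c d →
    a :* b :- c :* d := a :* (b :- d) :+ d :* (a :- c)) refl
    where open +-*-Solver

  *-scale : ∀ {C} a d θ → 0ℚ ℚ.< C → ℚ.∣ a ∣ ℚ.≤ C → ℚ.∣ d ∣ ℚ.< θ →
            ℚ.∣ a ℚ.* d ∣ ℚ.< C ℚ.* θ
  *-scale {C} a d θ 0<C a≤C d<θ = begin-strict
    ℚ.∣ a ℚ.* d ∣          ≡⟨ ℚ.∣p*q∣≡∣p∣*∣q∣ a d ⟩
    ℚ.∣ a ∣ ℚ.* ℚ.∣ d ∣    ≤⟨ ℚ.*-monoʳ-≤-nonNeg ℚ.∣ d ∣ {{ℚ.∣-∣-nonNeg d}} a≤C ⟩
    C ℚ.* ℚ.∣ d ∣          <⟨ ℚ.*-monoʳ-<-pos C {{ℚ.positive 0<C}} d<θ ⟩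
    C ℚ.* θ                ∎
    where open ℚ.≤-Reasoning

  *-close : ∀ {K L δ η ε} (a b c d : ℚ) → 0ℚ ℚ.< K → 0ℚ ℚ.< L →
            K ℚ.* δ ≡ ½ ℚ.* ε → L ℚ.* η ≡ ½ ℚ.* ε →
            ℚ.∣ a ∣ ℚ.≤ K → ℚ.∣ d ∣ ℚ.≤ L →
            ℚ.∣ b ℚ.- d ∣ ℚ.< δ → ℚ.∣ a ℚ.- c ∣ ℚ.< η →
            ℚ.∣ a ℚ.* b ℚ.- c ℚ.* d ∣ ℚ.< ε
  *-close {K} {L} {δ} {η} {ε} a b c d 0<K 0<L Kδ Lη a≤K d≤L b-d a-c = begin-strict
    ℚ.∣ a ℚ.* b ℚ.- c ℚ.* d ∣
      ≡⟨ cong ℚ.∣_∣ (*-rearrange a b c d) ⟩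
    ℚ.∣ a ℚ.* (b ℚ.- d) ℚ.+ d ℚ.* (a ℚ.- c) ∣
      ≤⟨ ℚ.∣p+q∣≤∣p∣+∣q∣ (a ℚ.* (b ℚ.- d)) (d ℚ.* (a ℚ.- c)) ⟩
    ℚ.∣ a ℚ.* (b ℚ.- d) ∣ ℚ.+ ℚ.∣ d ℚ.* (a ℚ.- c) ∣
      <⟨ ℚ.+-mono-< (*-scale a (b ℚ.- d) δ 0<K a≤K b-d)
                    (*-scale d (a ℚ.- c) η 0<L d≤L a-c) ⟩
    K ℚ.* δ ℚ.+ L ℚ.* η
      ≡⟨ cong₂ ℚ._+_ Kδ Lη ⟩
    ½ ℚ.* ε ℚ.+ ½ ℚ.* ε
      ≡⟨ halves ε ⟩
    ε ∎
    where open ℚ.≤-Reasoning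

  *-cauchy : ∀ (x y : ℝ) ε → 0ℚ ℚ.< ε → ∃[ N ] ∀ m n → N ℕ.≤ m → N ℕ.≤ n →
             ℚ.∣ seq x m ℚ.* seq y m ℚ.- seq x n ℚ.* seq y n ∣ ℚ.< ε
  *-cauchy x y ε 0<ε =
    let K , 0<K , M₁ , b₁ = eventuallyBounded x
        L , 0<L , M₂ , b₂ = eventuallyBounded y
        δ , 0<δ , Kδ = divide K (½ ℚ.* ε) 0<K (half-pos 0<ε)
        η , 0<η , Lη = divide L (½ ℚ.* ε) 0<L (half-pos 0<ε)
        N₁ , c₁ = cauchy y δ 0<δ
        N₂ , c₂ = cauchy x η 0<η
    in  (M₁ ℕ.⊔ M₂) ℕ.⊔ (N₁ ℕ.⊔ N₂) , λ m n N≤m N≤n →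
        let M≤m = ℕ.m⊔n≤o⇒m≤o (M₁ ℕ.⊔ M₂) (N₁ ℕ.⊔ N₂) N≤m
            M≤n = ℕ.m⊔n≤o⇒m≤o (M₁ ℕ.⊔ M₂) (N₁ ℕ.⊔ N₂) N≤n
            N≤m = ℕ.m⊔n≤o⇒n≤o (M₁ ℕ.⊔ M₂) (N₁ ℕ.⊔ N₂) N≤m
            N≤n = ℕ.m⊔n≤o⇒n≤o (M₁ ℕ.⊔ M₂) (N₁ ℕ.⊔ N₂) N≤n
        in  *-close (seq x m) (seq y m) (seq x n) (seq y n) 0<K 0<L Kδ Lη
              (b₁ m (ℕ.m⊔n≤o⇒m≤o M₁ M₂ M≤m))
              (b₂ n (ℕ.m⊔n≤o⇒n≤o M₁ M₂ M≤n))
              (c₁ m n (ℕ.m⊔n≤o⇒m≤o N₁ N₂ N≤m) (ℕ.m⊔n≤o⇒m≤o N₁ N₂ N≤n))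
              (c₂ m n (ℕ.m⊔n≤o⇒n≤o N₁ N₂ N≤m) (ℕ.m⊔n≤o⇒n≤o N₁ N₂ N≤n))

open ProductLemmas

_*ᴿ_ : ℝ → ℝ → ℝ
(x *ᴿ y) .seq n = seq x n ℚ.* seq y n
(x *ᴿ y) .cauchy = *-cauchy x y

ℝ-rawRing : RawRing 0ℓ 0ℓ
ℝ-rawRing = record
  { Carrier = ℝ ; _≈_ = _≈ᴿ_ ; _+_ = _+ᴿ_ ; _*_ = _*ᴿ_ ; -_ = -ᴿ_ ; 0# = 0ᴿ ; 1# = 1ᴿ }

open Sum (RawRing.+-rawMonoid ℝ-rawRing) public using () renaming (sum to sumᴿ)

record BipartiteGraph (n : ℕ) : Set where
  field
    adj        : Fin n → Fin n → Bool
    adj-sym    : ∀ u v → adj u v ≡ adj v u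
    adj-irrefl : ∀ u → adj u u ≡ false
    side       : Fin n → Bool
    bipartite  : ∀ u v → T (adj u v) → side u ≢ side v

module _ {n : ℕ} (G : BipartiteGraph n) where
  open BipartiteGraph G

  Adj : Fin n → Fin n → Set
  Adj u v = T (adj u v)

  degree : Fin n → ℕ
  degree u = length (filter (λ v → T? (adj u v)) (allFin n))

  Regular : ℕ → Set
  Regular d = ∀ u → degree u ≡ d

  BiRegular : Set
  BiRegular = ∀ u v → side u ≡ side v → degree u ≡ degree v

  -- `sort` for the flipped order sorts in non-increasing order.
  degreeSequence : Bool → List ℕ
  degreeSequence s =
    Sort.sort (flipOrder ℕ.≤-decTotalOrder)
      (map degree (filter (λ v → side v ≟ᵇ s) (allFin n)))

  adjacencyMatrix : Fin n → Fin n → ℝ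
  adjacencyMatrix u v = if adj u v then 1ᴿ else 0ᴿ

  -- v₀ ∷ v₁ ∷ … ∷ vₖ₋₁ ∷ [] traces the cycle v₀ v₁ … vₖ₋₁ v₀.
  IsCycle : List (Fin n) → Set
  IsCycle []       = ⊥
  IsCycle (v ∷ vs) =
    3 ℕ.≤ length (v ∷ vs) × Unique (v ∷ vs) × Linked Adj (v ∷ vs ++ [ v ])

  HasGirth : ℕ → Set
  HasGirth g = (∃[ vs ] (length vs ≡ g × IsCycle vs))
             × (∀ vs → IsCycle vs → g ℕ.≤ length vs)

-- A cycle of length k, as a subgraph, is traced by 2k vertex sequences
-- (k starting points, two directions).  Exactly one of them starts at the
-- smallest vertex and proceeds to the smaller of its two cycle neighbours.
Canonical : ∀ {n} → List (Fin n) → Set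
Canonical []       = ⊥
Canonical (v ∷ vs) = All (v Fin.<_) vs × Connected Fin._<_ (head vs) (last vs)

canonical? : ∀ {n} → Decidable (Canonical {n})
canonical? []       = no λ ()
canonical? (v ∷ vs) = all? (v Fin.<?_) vs ×-dec connected? Fin._<?_ (head vs) (last vs)

isCycle? : ∀ {n} (G : BipartiteGraph n) → Decidable (IsCycle G)
isCycle? G []       = no λ ()
isCycle? G (v ∷ vs) =
  3 ℕ.≤? length (v ∷ vs)
  ×-dec DecUnique.unique? Fin._≟_ (v ∷ vs)
  ×-dec linked? (λ u w → T? (BipartiteGraph.adj G u w)) (v ∷ vs ++ [ v ])

tuples : ∀ {a} {A : Set a} → List A → ℕ → List (List A)
tuples xs zero    = [ [] ]
tuples xs (suc k) = cartesianProductWith _∷_ xs (tuples xs k)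

numCycles : ∀ {n} → BipartiteGraph n → ℕ → ℕ
numCycles {n} G k =
  length (filter (λ vs → isCycle? G vs ×-dec canonical? vs) (tuples (allFin n) k))

LinearlyIndependent : ∀ {m n} → (Fin m → Vector ℝ n) → Set
LinearlyIndependent {m} {n} v =
  (c : Vector ℝ m) →
  (∀ i → sumᴿ (λ k → c k *ᴿ v k i) ≈ᴿ 0ᴿ) →
  ∀ k → c k ≈ᴿ 0ᴿ

IsEigenpair : ∀ {n} → (Fin n → Fin n → ℝ) → ℝ → Vector ℝ n → Set
IsEigenpair A μ x = ∀ i → sumᴿ (λ j → A i j *ᴿ x j) ≈ᴿ μ *ᴿ x i

-- Λ lists the n eigenvalues of the adjacency matrix with multiplicity, in
-- some order.  The matrix is real symmetric, so eigenvectors span, and an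
-- independent family of n of them uses each eigenvalue exactly as often as
-- the dimension of its eigenspace.
IsSpectrum : ∀ {n} → BipartiteGraph n → Vector ℝ n → Set
IsSpectrum {n} G Λ =
  Σ[ v ∈ (Fin n → Vector ℝ n) ]
    ((∀ k → IsEigenpair (adjacencyMatrix G) (Λ k) (v k)) × LinearlyIndependent v)

SameSpectrum : ∀ {n} → BipartiteGraph n → BipartiteGraph n → Set
SameSpectrum G H = ∃[ Λ ] (IsSpectrum G Λ × IsSpectrum H Λ)

SameDegreeSequences : ∀ {n} → BipartiteGraph n → BipartiteGraph n → Set
SameDegreeSequences G H = ∀ s → degreeSequence G s ≡ degreeSequence H s

-- The number of i-cycles of bi-regular bipartite graphs of girth g is a
-- function of the spectrum and the two degree sequences.  f is an arbitrary
-- function of the data: it is not assumed to respect ≈ᴿ or the order of Λ,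
-- which makes the negation of this property only stronger.
DeterminedBySpectrumAndDegrees : (g i : ℕ) → Set
DeterminedBySpectrumAndDegrees g i =
  Σ[ f ∈ (∀ {n} → Vector ℝ n → List ℕ → List ℕ → ℕ) ]
    (∀ {n} (G : BipartiteGraph n) → BiRegular G → HasGirth G g →
     ∀ Λ → IsSpectrum G Λ →
     numCycles G i ≡ f Λ (degreeSequence G true) (degreeSequence G false))

{-# OPTIONS --safe #-}
module Submission where

-- G and H are the incidence graphs of two configurations of 12 points and 12
-- lines.  With N the 12 × 12 incidence matrix, the eigenvalues of both graphs
-- are ±σ for σ² an eigenvalue of N Nᵀ: σ = 0, 1, 2, 3, √3 (four times),
-- α = (√3 + √7)/2 and √3 - α (twice each).  Since α² = √3 α + 1, eigenvectors
-- can be written over ℤ[√3, α], where being an eigenvector and being orthogonal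
-- are decided by evaluation; an orthogonal family whose squared norms have
-- nonzero norm over ℚ stays independent over ℝ.  The numbers of cycles are
-- evaluated too, after replacing the enumeration of all tuples by a depth-first
-- search, and they differ in every even length from 12 to 24.

open import Defs
open import Algebra.Bundles using (RawRing; Semiring; CommutativeRing)
import Algebra.Definitions.RawMonoid as Sum
open import Algebra.Morphism.Structures using (IsSemiringHomomorphism)
import Algebra.Properties.Semiring.Sum as SemiringSum
import Algebra.Solver.Ring.NaturalCoefficients.Default as SemiringSolver
import Data.Bool.ListAction as Bool
open import Data.Bool.Base using (Bool; true; false; T; if_then_else_)
open import Data.Bool.Properties using (T?)
open import Data.Empty using (⊥-elim)
open import Data.Fin.Base as Fin using (Fin; zero; suc; toℕ; punchIn; splitAt)
open import Data.Fin using (#_)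
import Data.Fin.Properties as Fin
open import Data.Integer.Base as ℤ using (ℤ; +_; -[1+_]; 0ℤ; 1ℤ)
import Data.Integer.Literals as ℤ-Literals
import Data.Integer.Properties as ℤ
import Data.Integer.Solver as ℤ-Solver
open import Data.List.Base
  using (List; []; _∷_; [_]; _++_; map; filter; length; last; allFin; cartesianProductWith)
open import Data.List.Properties using (map-cong; length-++; filter-++; filter-≐; filter-none)
open import Data.List.Relation.Unary.All as All using (All; []; _∷_)
open import Data.List.Relation.Unary.Linked using (Linked; [-]; _∷_)
open import Data.List.Relation.Unary.Unique.Propositional using (Unique; []; _∷_)
import Data.List.Sort as Sort
open import Data.Maybe.Base using (just)
open import Data.Maybe.Relation.Binary.Connected using (Connected; just; drop-just)
open import Data.Nat.Base as ℕ using (ℕ; zero; suc; z≤n; s≤s)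
open import Data.Nat.Divisibility.Core using (divides)
open import Data.Nat.ListAction using () renaming (sum to sumᴺ)
import Data.Nat.Properties as ℕ
import Data.Nat.Solver as ℕ-Solver
open import Data.Product.Base using (Σ-syntax; ∃-syntax; _×_; _,_; proj₁; proj₂)
open import Data.Rational.Base as ℚ using (ℚ; 0ℚ; 1ℚ; ½; mkℚ)
open import Data.Rational.Literals using (fromℤ)
import Data.Rational.Properties as ℚ
open import Data.Rational.Solver using (module +-*-Solver)
open import Data.Rational.Unnormalised.Base using (*≡*; *<*)
import Data.Rational.Unnormalised.Properties as ℚᵘ
open import Data.Sum.Base using (_⊎_; inj₁; inj₂; [_,_]′)
open import Data.Unit.Base using (⊤)
open import Data.Vec.Base as Vec using (Vec; []; _∷_; lookup; tabulate; _[_]≔_)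
open import Data.Vec.Functional using (Vector)
open import Data.Vec.Properties using (lookup∘tabulate; lookup∘update; lookup∘update′)
open import Function.Base using (_∘_; const)
open import Level using (0ℓ)
open import Relation.Binary.Construct.Flip.EqAndOrd using () renaming (decTotalOrder to flipOrder)
open import Relation.Binary.Definitions using (DecidableEquality)
open import Relation.Binary.PropositionalEquality as ≡
  using (_≡_; _≢_; refl; sym; trans; cong; cong₂; subst; subst₂)
open import Relation.Binary.Structures using (IsEquivalence)
open import Relation.Nullary.Decidable.Core using (Dec; does; yes; no; ¬?; _×-dec_; _⊎-dec_; _→-dec_; map′)
open import Relation.Nullary.Negation.Core using (¬_; contradiction)
open import Relation.Unary using (Pred; Decidable; _≐_)
open CauchyLemmas
open ProductLemmas

-- The commutative ring of real numbers

-- Equality in `ℝ` is a statement about limits and cannot be decided by computation, so every finite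
-- check takes place in ℤ[√3, α] and a homomorphism carries the result over. The number α comes from
-- the factor x² - 5x + 1 of the characteristic polynomial of N Nᵀ: its roots are (5 ± √21)/2 = ((√3
-- ± √7)/2)². Independence is the delicate half of a spectrum. Pairing a dependency with one
-- eigenvector of an orthogonal family leaves c ⟨v, v⟩ ≈ 0, and cancelling needs an inverse of ⟨v,
-- v⟩ in `ℝ`, which is more than ⟨v, v⟩ being nonzero. Multiplying by the conjugates turns ⟨v, v⟩
-- into a nonzero integer, whose inverse is an explicit rational. N has rank 11, so 0 is a double
-- eigenvalue of each graph, and its eigenvectors need separate data. On the side of the cycles,
-- being simple and canonical are global conditions on a tuple; they are rephrased so that they can
-- be tested vertex by vertex, since even the 24¹² tuples of length 12 are out of reach. No cycle is
-- longer than the 24 vertices, which is where the range of lengths ends.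

≗⇒≈ᴿ : ∀ {x y} → (∀ n → seq x n ≡ seq y n) → x ≈ᴿ y
≗⇒≈ᴿ {x} {y} x≗y ε 0<ε = 0 , λ n _ → subst (ℚ._< ε) (sym (distance n)) 0<ε
  where
  distance : ∀ n → ℚ.∣ seq x n ℚ.- seq y n ∣ ≡ 0ℚ
  distance n = cong ℚ.∣_∣ (trans (cong (ℚ._- seq y n) (x≗y n)) (ℚ.+-inverseʳ (seq y n)))

≈ᴿ-sym : ∀ {x y} → x ≈ᴿ y → y ≈ᴿ x
≈ᴿ-sym {x} {y} x≈y ε 0<ε with x≈y ε 0<ε
... | N , close = N , λ n N≤n → subst (ℚ._< ε) (swap (seq x n) (seq y n)) (close n N≤n)
  where
  swap : ∀ a b → ℚ.∣ a ℚ.- b ∣ ≡ ℚ.∣ b ℚ.- a ∣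
  swap a b = trans (sym (ℚ.∣-p∣≡∣p∣ (a ℚ.- b))) (cong ℚ.∣_∣ (neg a b))
    where
    open +-*-Solver
    neg : ∀ a b → ℚ.- (a ℚ.- b) ≡ b ℚ.- a
    neg = solve 2 (λ a b → :- (a :- b) := b :- a) refl

-- The ε/2 argument shared by transitivity and by congruence of addition, which differ only in how
-- the error splits.
≈ᴿ-additive : ∀ {x y x₁ y₁ x₂ y₂} →
  (∀ n → seq x n ℚ.- seq y n ≡ (seq x₁ n ℚ.- seq y₁ n) ℚ.+ (seq x₂ n ℚ.- seq y₂ n)) →
  x₁ ≈ᴿ y₁ → x₂ ≈ᴿ y₂ → x ≈ᴿ y
≈ᴿ-additive {x} {y} {x₁} {y₁} {x₂} {y₂} error eq₁ eq₂ ε 0<ε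
  with eq₁ (½ ℚ.* ε) (half-pos 0<ε) | eq₂ (½ ℚ.* ε) (half-pos 0<ε)
... | N₁ , c₁ | N₂ , c₂ = N₁ ℕ.⊔ N₂ , λ n N≤n → begin-strict
  ℚ.∣ seq x n ℚ.- seq y n ∣
    ≡⟨ cong ℚ.∣_∣ (error n) ⟩
  ℚ.∣ (seq x₁ n ℚ.- seq y₁ n) ℚ.+ (seq x₂ n ℚ.- seq y₂ n) ∣
    ≤⟨ ℚ.∣p+q∣≤∣p∣+∣q∣ (seq x₁ n ℚ.- seq y₁ n) (seq x₂ n ℚ.- seq y₂ n) ⟩
  ℚ.∣ seq x₁ n ℚ.- seq y₁ n ∣ ℚ.+ ℚ.∣ seq x₂ n ℚ.- seq y₂ n ∣
    <⟨ ℚ.+-mono-< (c₁ n (ℕ.m⊔n≤o⇒m≤o N₁ N₂ N≤n)) (c₂ n (ℕ.m⊔n≤o⇒n≤o N₁ N₂ N≤n)) ⟩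
  ½ ℚ.* ε ℚ.+ ½ ℚ.* ε
    ≡⟨ halves ε ⟩
  ε ∎
  where open ℚ.≤-Reasoning

≈ᴿ-trans : ∀ {x y z} → x ≈ᴿ y → y ≈ᴿ z → x ≈ᴿ z
≈ᴿ-trans {x} {y} {z} =
  ≈ᴿ-additive {x} {z} {x} {y} {y} {z} λ n → telescope (seq x n) (seq y n) (seq z n)
  where
  open +-*-Solver
  telescope : ∀ a b c → a ℚ.- c ≡ (a ℚ.- b) ℚ.+ (b ℚ.- c)
  telescope = solve 3 (λ a b c → a :- c := (a :- b) :+ (b :- c)) refl

+ᴿ-cong : ∀ {x y u v} → x ≈ᴿ y → u ≈ᴿ v → x +ᴿ u ≈ᴿ y +ᴿ v
+ᴿ-cong {x} {y} {u} {v} =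
  ≈ᴿ-additive {x +ᴿ u} {y +ᴿ v} {x} {y} {u} {v}
    λ n → rearrange (seq x n) (seq y n) (seq u n) (seq v n)
  where
  open +-*-Solver
  rearrange : ∀ a b c d → (a ℚ.+ c) ℚ.- (b ℚ.+ d) ≡ (a ℚ.- b) ℚ.+ (c ℚ.- d)
  rearrange = solve 4 (λ a b c d → (a :+ c) :- (b :+ d) := (a :- b) :+ (c :- d)) refl

-ᴿ-cong : ∀ {x y} → x ≈ᴿ y → -ᴿ x ≈ᴿ -ᴿ y
-ᴿ-cong {x} {y} x≈y ε 0<ε with x≈y ε 0<ε
... | N , close = N , λ n N≤n → subst (ℚ._< ε) (swap (seq x n) (seq y n)) (close n N≤n)
  where
  swap : ∀ a b → ℚ.∣ a ℚ.- b ∣ ≡ ℚ.∣ (ℚ.- a) ℚ.- (ℚ.- b) ∣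
  swap a b = trans (sym (ℚ.∣-p∣≡∣p∣ (a ℚ.- b))) (cong ℚ.∣_∣ (ℚ.neg-distrib-+ a (ℚ.- b)))

*ᴿ-cong : ∀ {x y u v} → x ≈ᴿ y → u ≈ᴿ v → x *ᴿ u ≈ᴿ y *ᴿ v
*ᴿ-cong {x} {y} {u} {v} x≈y u≈v ε 0<ε =
  let K , 0<K , M₁ , b₁ = eventuallyBounded x
      L , 0<L , M₂ , b₂ = eventuallyBounded v
      δ , 0<δ , Kδ = divide K (½ ℚ.* ε) 0<K (half-pos 0<ε)
      η , 0<η , Lη = divide L (½ ℚ.* ε) 0<L (half-pos 0<ε)
      N₁ , c₁ = u≈v δ 0<δ
      N₂ , c₂ = x≈y η 0<η
  in  (M₁ ℕ.⊔ M₂) ℕ.⊔ (N₁ ℕ.⊔ N₂) , λ n N≤n →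
      let M≤n = ℕ.m⊔n≤o⇒m≤o (M₁ ℕ.⊔ M₂) (N₁ ℕ.⊔ N₂) N≤n
          N≤n = ℕ.m⊔n≤o⇒n≤o (M₁ ℕ.⊔ M₂) (N₁ ℕ.⊔ N₂) N≤n
      in  *-close (seq x n) (seq u n) (seq y n) (seq v n) 0<K 0<L Kδ Lη
            (b₁ n (ℕ.m⊔n≤o⇒m≤o M₁ M₂ M≤n))
            (b₂ n (ℕ.m⊔n≤o⇒n≤o M₁ M₂ M≤n))
            (c₁ n (ℕ.m⊔n≤o⇒m≤o N₁ N₂ N≤n))
            (c₂ n (ℕ.m⊔n≤o⇒n≤o N₁ N₂ N≤n))

ℝ-isEquivalence : IsEquivalence _≈ᴿ_
ℝ-isEquivalence = record
  { refl  = λ {x} → ≗⇒≈ᴿ {x} {x} λ _ → refl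
  ; sym   = λ {x} {y} → ≈ᴿ-sym {x} {y}
  ; trans = λ {x} {y} {z} → ≈ᴿ-trans {x} {y} {z}
  }

ℝ-commutativeRing : CommutativeRing 0ℓ 0ℓ
ℝ-commutativeRing = record
  { Carrier = ℝ ; _≈_ = _≈ᴿ_ ; _+_ = _+ᴿ_ ; _*_ = _*ᴿ_ ; -_ = -ᴿ_ ; 0# = 0ᴿ ; 1# = 1ᴿ
  ; isCommutativeRing = record
    { isRing = record
      { +-isAbelianGroup = record
        { isGroup = record
          { isMonoid = record
            { isSemigroup = record
              { isMagma = record
                { isEquivalence = ℝ-isEquivalence
                ; ∙-cong = λ {x} {y} {u} {v} → +ᴿ-cong {x} {y} {u} {v}
                }
              ; assoc = λ x y z → ≗⇒≈ᴿ {(x +ᴿ y) +ᴿ z} {x +ᴿ (y +ᴿ z)} λ n → ℚ.+-assoc (seq x n) (seq y n) (seq z n)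
              }
            ; identity = (λ x → ≗⇒≈ᴿ {0ᴿ +ᴿ x} {x} λ n → ℚ.+-identityˡ (seq x n))
                       , (λ x → ≗⇒≈ᴿ {x +ᴿ 0ᴿ} {x} λ n → ℚ.+-identityʳ (seq x n))
            }
          ; inverse = (λ x → ≗⇒≈ᴿ {(-ᴿ x) +ᴿ x} {0ᴿ} λ n → ℚ.+-inverseˡ (seq x n))
                    , (λ x → ≗⇒≈ᴿ {x +ᴿ (-ᴿ x)} {0ᴿ} λ n → ℚ.+-inverseʳ (seq x n))
          ; ⁻¹-cong = λ {x} {y} → -ᴿ-cong {x} {y}
          }
        ; comm = λ x y → ≗⇒≈ᴿ {x +ᴿ y} {y +ᴿ x} λ n → ℚ.+-comm (seq x n) (seq y n)
        }
      ; *-cong = λ {x} {y} {u} {v} → *ᴿ-cong {x} {y} {u} {v}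
      ; *-assoc = λ x y z → ≗⇒≈ᴿ {(x *ᴿ y) *ᴿ z} {x *ᴿ (y *ᴿ z)} λ n → ℚ.*-assoc (seq x n) (seq y n) (seq z n)
      ; *-identity = (λ x → ≗⇒≈ᴿ {1ᴿ *ᴿ x} {x} λ n → ℚ.*-identityˡ (seq x n))
                   , (λ x → ≗⇒≈ᴿ {x *ᴿ 1ᴿ} {x} λ n → ℚ.*-identityʳ (seq x n))
      ; distrib = (λ x y z → ≗⇒≈ᴿ {x *ᴿ (y +ᴿ z)} {(x *ᴿ y) +ᴿ (x *ᴿ z)} λ n → ℚ.*-distribˡ-+ (seq x n) (seq y n) (seq z n))
                , (λ x y z → ≗⇒≈ᴿ {(y +ᴿ z) *ᴿ x} {(y *ᴿ x) +ᴿ (z *ᴿ x)} λ n → ℚ.*-distribʳ-+ (seq x n) (seq y n) (seq z n))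
      }
    ; *-comm = λ x y → ≗⇒≈ᴿ {x *ᴿ y} {y *ᴿ x} λ n → ℚ.*-comm (seq x n) (seq y n)
    }
  }

-- Square roots

fromℤ-+ : ∀ i j → fromℤ (i ℤ.+ j) ≡ fromℤ i ℚ.+ fromℤ j
fromℤ-+ i j = ℚ.toℚᵘ-injective
  (ℚᵘ.≃-trans (*≡* (identity i j)) (ℚᵘ.≃-sym (ℚ.toℚᵘ-homo-+ (fromℤ i) (fromℤ j))))
  where
  open ℤ-Solver.+-*-Solver
  identity : ∀ i j → (i ℤ.+ j) ℤ.* (+ 1) ≡ (i ℤ.* + 1 ℤ.+ j ℤ.* + 1) ℤ.* + 1
  identity = solve 2 (λ i j → (i :+ j) :* con (+ 1) := (i :* con (+ 1) :+ j :* con (+ 1)) :* con (+ 1)) refl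

fromℤ-* : ∀ i j → fromℤ (i ℤ.* j) ≡ fromℤ i ℚ.* fromℤ j
fromℤ-* i j = ℚ.toℚᵘ-injective
  (ℚᵘ.≃-trans (*≡* refl) (ℚᵘ.≃-sym (ℚ.toℚᵘ-homo-* (fromℤ i) (fromℤ j))))

fromℤ-mono-≤ : ∀ {i j} → i ℤ.≤ j → fromℤ i ℚ.≤ fromℤ j
fromℤ-mono-≤ i≤j = ℚ.*≤* (ℤ.*-monoʳ-≤-nonNeg (+ 1) i≤j)

fromℕ : ℕ → ℚ
fromℕ n = fromℤ (+ n)

fromℕ-mono-≤ : ∀ {m n} → m ℕ.≤ n → fromℕ m ℚ.≤ fromℕ n
fromℕ-mono-≤ m≤n = fromℤ-mono-≤ (ℤ.+≤+ m≤n)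

fromℕ-* : ∀ m n → fromℕ (m ℕ.* n) ≡ fromℕ m ℚ.* fromℕ n
fromℕ-* m n = trans (cong fromℤ (ℤ.pos-* m n)) (fromℤ-* (+ m) (+ n))

-- For ε = (a + 1)/(d + 1) the numerator is at least 1, so n > d + 1 already gives n ε > 1.
archimedean : ∀ ε → 0ℚ ℚ.< ε → ∃[ N ] ∀ n → N ℕ.≤ n → 1ℚ ℚ.< fromℕ n ℚ.* ε
archimedean (mkℚ (+ zero) d c) (ℚ.*<* (ℤ.+<+ ()))
archimedean (mkℚ -[1+ a ] d c) (ℚ.*<* ())
archimedean ε@(mkℚ (+ suc a) d _) _ = suc (suc d) , λ n N≤n →
  ℚ.toℚᵘ-cancel-< (ℚᵘ.<-respʳ-≃ (ℚᵘ.≃-sym (ℚ.toℚᵘ-homo-* (fromℕ n) ε))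
    (*<* (subst₂ ℤ._<_ (sym (ℤ.*-identityˡ (+ suc (d ℕ.+ 0))))
                       (trans (ℤ.pos-* n (suc a)) (sym (ℤ.*-identityʳ (+ n ℤ.* + suc a))))
      (ℤ.+<+ (ℕ.<-≤-trans (subst (ℕ._< n) (cong suc (sym (ℕ.+-identityʳ d))) N≤n)
                          (ℕ.m≤m*n n (suc a)))))))

-- |a - b| ≤ |a² - b²| for a, b ≥ 1, so a sequence of rationals ≥ 1 is Cauchy
-- as soon as its squares are.
module _ (s : ℕ → ℚ) (m : ℚ) (1≤s : ∀ n → 1ℚ ℚ.≤ s n)
         (s²→m : ∀ ε → 0ℚ ℚ.< ε → ∃[ N ] ∀ n → N ℕ.≤ n → ℚ.∣ s n ℚ.* s n ℚ.- m ∣ ℚ.< ε)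
  where

  distance-≤-squares : ∀ a b → 1ℚ ℚ.≤ a → 1ℚ ℚ.≤ b → ℚ.∣ a ℚ.- b ∣ ℚ.≤ ℚ.∣ a ℚ.* a ℚ.- b ℚ.* b ∣
  distance-≤-squares a b 1≤a 1≤b = begin
    ℚ.∣ a ℚ.- b ∣
      ≡⟨ ℚ.*-identityʳ ℚ.∣ a ℚ.- b ∣ ⟨
    ℚ.∣ a ℚ.- b ∣ ℚ.* 1ℚ
      ≤⟨ ℚ.*-monoˡ-≤-nonNeg ℚ.∣ a ℚ.- b ∣ {{ℚ.∣-∣-nonNeg (a ℚ.- b)}} 1≤a+b ⟩
    ℚ.∣ a ℚ.- b ∣ ℚ.* (a ℚ.+ b)
      ≡⟨ cong (ℚ.∣ a ℚ.- b ∣ ℚ.*_) (ℚ.0≤p⇒∣p∣≡p (ℚ.≤-trans (ℚ.nonNegative⁻¹ 1ℚ) 1≤a+b)) ⟨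
    ℚ.∣ a ℚ.- b ∣ ℚ.* ℚ.∣ a ℚ.+ b ∣
      ≡⟨ ℚ.∣p*q∣≡∣p∣*∣q∣ (a ℚ.- b) (a ℚ.+ b) ⟨
    ℚ.∣ (a ℚ.- b) ℚ.* (a ℚ.+ b) ∣
      ≡⟨ cong ℚ.∣_∣ (factor a b) ⟩
    ℚ.∣ a ℚ.* a ℚ.- b ℚ.* b ∣ ∎
    where
    open ℚ.≤-Reasoning
    1≤a+b : 1ℚ ℚ.≤ a ℚ.+ b
    1≤a+b = subst (ℚ._≤ a ℚ.+ b) (ℚ.+-identityʳ 1ℚ)
              (ℚ.+-mono-≤ 1≤a (ℚ.≤-trans (ℚ.nonNegative⁻¹ 1ℚ) 1≤b))
    factor : ∀ a b → (a ℚ.- b) ℚ.* (a ℚ.+ b) ≡ a ℚ.* a ℚ.- b ℚ.* b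
    factor = solve 2 (λ a b → (a :- b) :* (a :+ b) := a :* a :- b :* b) refl
      where open +-*-Solver

  sqrtLimit : ℝ
  sqrtLimit .seq = s
  sqrtLimit .cauchy ε 0<ε with s²→m (½ ℚ.* ε) (half-pos 0<ε)
  ... | N , close = N , λ i j N≤i N≤j → begin-strict
    ℚ.∣ s i ℚ.- s j ∣
      ≤⟨ distance-≤-squares (s i) (s j) (1≤s i) (1≤s j) ⟩
    ℚ.∣ s i ℚ.* s i ℚ.- s j ℚ.* s j ∣
      ≡⟨ cong ℚ.∣_∣ (viaLimit (s i ℚ.* s i) (s j ℚ.* s j) m) ⟩
    ℚ.∣ (s i ℚ.* s i ℚ.- m) ℚ.- (s j ℚ.* s j ℚ.- m) ∣
      ≤⟨ ℚ.∣p-q∣≤∣p∣+∣q∣ (s i ℚ.* s i ℚ.- m) (s j ℚ.* s j ℚ.- m) ⟩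
    ℚ.∣ s i ℚ.* s i ℚ.- m ∣ ℚ.+ ℚ.∣ s j ℚ.* s j ℚ.- m ∣
      <⟨ ℚ.+-mono-< (close i N≤i) (close j N≤j) ⟩
    ½ ℚ.* ε ℚ.+ ½ ℚ.* ε
      ≡⟨ halves ε ⟩
    ε ∎
    where
    open ℚ.≤-Reasoning
    viaLimit : ∀ a b c → a ℚ.- b ≡ (a ℚ.- c) ℚ.- (b ℚ.- c)
    viaLimit = solve 3 (λ a b c → a :- b := (a :- c) :- (b :- c)) refl
      where open +-*-Solver

  sqrtLimit² : sqrtLimit *ᴿ sqrtLimit ≈ᴿ fromℚ m
  sqrtLimit² = s²→m

-- If x² - m y² = 1, then the powers pₙ + qₙ√m of x + y√m all satisfy
-- pₙ² - m qₙ² = 1, so (pₙ / qₙ)² - m = 1 / qₙ² tends to 0.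
module Pell (x y m : ℕ) .{{_ : ℕ.NonZero x}} .{{_ : ℕ.NonZero y}} .{{_ : ℕ.NonZero m}}
            (x²≡1+my² : x ℕ.* x ≡ 1 ℕ.+ m ℕ.* (y ℕ.* y)) where

  pq : ℕ → ℕ × ℕ
  pq zero    = x , y
  pq (suc n) = let p , q = pq n in x ℕ.* p ℕ.+ m ℕ.* y ℕ.* q , y ℕ.* p ℕ.+ x ℕ.* q

  p q : ℕ → ℕ
  p n = proj₁ (pq n)
  q n = proj₂ (pq n)

  -- Brahmagupta's identity, arranged without subtraction: both sides expand with the same term
  -- `cross`, and the rest agrees once the two Pell equations are substituted.
  p²≡1+mq² : ∀ n → p n ℕ.* p n ≡ 1 ℕ.+ m ℕ.* (q n ℕ.* q n)
  p²≡1+mq² zero    = x²≡1+my²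
  p²≡1+mq² (suc n) = begin
    p (suc n) ℕ.* p (suc n)
      ≡⟨ expandˡ x y m (p n) (q n) ⟩
    (x ℕ.* x) ℕ.* (p n ℕ.* p n) ℕ.+ (m ℕ.* Y ℕ.* (m ℕ.* Q) ℕ.+ cross)
      ≡⟨ cong (ℕ._+ (m ℕ.* Y ℕ.* (m ℕ.* Q) ℕ.+ cross)) (cong₂ ℕ._*_ x²≡1+my² (p²≡1+mq² n)) ⟩
    (1 ℕ.+ m ℕ.* Y) ℕ.* (1 ℕ.+ m ℕ.* Q) ℕ.+ (m ℕ.* Y ℕ.* (m ℕ.* Q) ℕ.+ cross)
      ≡⟨ brahmagupta m Y Q cross ⟩
    1 ℕ.+ (m ℕ.* (Y ℕ.* (1 ℕ.+ m ℕ.* Q) ℕ.+ (1 ℕ.+ m ℕ.* Y) ℕ.* Q) ℕ.+ cross)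
      ≡⟨ cong (λ z → 1 ℕ.+ (m ℕ.* z ℕ.+ cross))
           (cong₂ (λ a b → Y ℕ.* b ℕ.+ a ℕ.* Q) x²≡1+my² (p²≡1+mq² n)) ⟨
    1 ℕ.+ (m ℕ.* (Y ℕ.* (p n ℕ.* p n) ℕ.+ (x ℕ.* x) ℕ.* Q) ℕ.+ cross)
      ≡⟨ cong (1 ℕ.+_) (expandʳ x y m (p n) (q n)) ⟨
    1 ℕ.+ m ℕ.* (q (suc n) ℕ.* q (suc n)) ∎
    where
    open ≡.≡-Reasoning
    open ℕ-Solver.+-*-Solver
    Y = y ℕ.* y
    Q = q n ℕ.* q n
    cross = 2 ℕ.* (m ℕ.* (x ℕ.* y ℕ.* (p n ℕ.* q n)))
    expandˡ : ∀ x y m p q → (x ℕ.* p ℕ.+ m ℕ.* y ℕ.* q) ℕ.* (x ℕ.* p ℕ.+ m ℕ.* y ℕ.* q)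
            ≡ (x ℕ.* x) ℕ.* (p ℕ.* p) ℕ.+ (m ℕ.* (y ℕ.* y) ℕ.* (m ℕ.* (q ℕ.* q)) ℕ.+ 2 ℕ.* (m ℕ.* (x ℕ.* y ℕ.* (p ℕ.* q))))
    expandˡ = solve 5 (λ x y m p q →
      (x :* p :+ m :* y :* q) :* (x :* p :+ m :* y :* q)
      := (x :* x) :* (p :* p) :+ (m :* (y :* y) :* (m :* (q :* q)) :+ con 2 :* (m :* (x :* y :* (p :* q))))) refl
    expandʳ : ∀ x y m p q → m ℕ.* ((y ℕ.* p ℕ.+ x ℕ.* q) ℕ.* (y ℕ.* p ℕ.+ x ℕ.* q))
            ≡ m ℕ.* (y ℕ.* y ℕ.* (p ℕ.* p) ℕ.+ (x ℕ.* x) ℕ.* (q ℕ.* q)) ℕ.+ 2 ℕ.* (m ℕ.* (x ℕ.* y ℕ.* (p ℕ.* q)))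
    expandʳ = solve 5 (λ x y m p q →
      m :* ((y :* p :+ x :* q) :* (y :* p :+ x :* q))
      := m :* (y :* y :* (p :* p) :+ (x :* x) :* (q :* q)) :+ con 2 :* (m :* (x :* y :* (p :* q)))) refl
    brahmagupta : ∀ m Y Q c → (1 ℕ.+ m ℕ.* Y) ℕ.* (1 ℕ.+ m ℕ.* Q) ℕ.+ (m ℕ.* Y ℕ.* (m ℕ.* Q) ℕ.+ c)
                ≡ 1 ℕ.+ (m ℕ.* (Y ℕ.* (1 ℕ.+ m ℕ.* Q) ℕ.+ (1 ℕ.+ m ℕ.* Y) ℕ.* Q) ℕ.+ c)
    brahmagupta = solve 4 (λ m Y Q c →
      (con 1 :+ m :* Y) :* (con 1 :+ m :* Q) :+ (m :* Y :* (m :* Q) :+ c)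
      := con 1 :+ (m :* (Y :* (con 1 :+ m :* Q) :+ (con 1 :+ m :* Y) :* Q) :+ c)) refl

  q<p : ∀ n → q n ℕ.< p n
  q<p n = ℕ.≰⇒> λ p≤q → ℕ.<⇒≱ q²<p² (ℕ.*-mono-≤ p≤q p≤q)
    where
    q²<p² : q n ℕ.* q n ℕ.< p n ℕ.* p n
    q²<p² = subst (q n ℕ.* q n ℕ.<_) (sym (p²≡1+mq² n)) (s≤s (ℕ.m≤n*m (q n ℕ.* q n) m))

  n<q : ∀ n → n ℕ.< q n
  n<q zero    = ℕ.>-nonZero⁻¹ y
  n<q (suc n) = begin-strict
    suc n                        ≤⟨ n<q n ⟩
    q n                          <⟨ q<p n ⟩
    p n                          ≤⟨ ℕ.m≤n*m (p n) y ⟩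
    y ℕ.* p n                    ≤⟨ ℕ.m≤m+n (y ℕ.* p n) (x ℕ.* q n) ⟩
    y ℕ.* p n ℕ.+ x ℕ.* q n      ∎
    where open ℕ.≤-Reasoning

  private
    M : ℚ
    M = fromℕ m

    P Q : ℕ → ℚ
    P n = fromℕ (p n)
    Q n = fromℕ (q n)

    Q-pos : ∀ n → ℚ.Positive (Q n)
    Q-pos n with q n | n<q n
    ... | suc _ | _ = _

    r : ℕ → ℚ
    r n = (ℚ.1/ Q n) {{ℚ.pos⇒nonZero (Q n) {{Q-pos n}}}}

    Q*r≡1 : ∀ n → Q n ℚ.* r n ≡ 1ℚ
    Q*r≡1 n = ℚ.*-inverseʳ (Q n) {{ℚ.pos⇒nonZero (Q n) {{Q-pos n}}}}

    r-pos : ∀ n → ℚ.Positive (r n)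
    r-pos n = ℚ.1/pos⇒pos (Q n) {{Q-pos n}}

    r≤1 : ∀ n → r n ℚ.≤ 1ℚ
    r≤1 n = begin
      r n           ≡⟨ ℚ.*-identityˡ (r n) ⟨
      1ℚ ℚ.* r n    ≤⟨ ℚ.*-monoʳ-≤-nonNeg (r n) {{ℚ.pos⇒nonNeg (r n) {{r-pos n}}}} (fromℕ-mono-≤ (ℕ.≤-trans (s≤s z≤n) (n<q n))) ⟩
      Q n ℚ.* r n   ≡⟨ Q*r≡1 n ⟩
      1ℚ            ∎
      where open ℚ.≤-Reasoning

    s : ℕ → ℚ
    s n = P n ℚ.* r n

    1≤s : ∀ n → 1ℚ ℚ.≤ s n
    1≤s n = subst (ℚ._≤ s n) (Q*r≡1 n)
      (ℚ.*-monoʳ-≤-nonNeg (r n) {{ℚ.pos⇒nonNeg (r n) {{r-pos n}}}} (fromℕ-mono-≤ (ℕ.<⇒≤ (q<p n))))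

    error : ∀ n → s n ℚ.* s n ℚ.- M ≡ r n ℚ.* r n
    error n = begin
      s n ℚ.* s n ℚ.- M
        ≡⟨ regroup (P n) (r n) M ⟩
      P n ℚ.* P n ℚ.* (r n ℚ.* r n) ℚ.- M
        ≡⟨ cong (λ z → z ℚ.* (r n ℚ.* r n) ℚ.- M) pell ⟩
      (1ℚ ℚ.+ M ℚ.* (Q n ℚ.* Q n)) ℚ.* (r n ℚ.* r n) ℚ.- M
        ≡⟨ expand M (Q n) (r n) ⟩
      r n ℚ.* r n ℚ.+ (M ℚ.* ((Q n ℚ.* r n) ℚ.* (Q n ℚ.* r n)) ℚ.- M)
        ≡⟨ cong (λ z → r n ℚ.* r n ℚ.+ (M ℚ.* (z ℚ.* z) ℚ.- M)) (Q*r≡1 n) ⟩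
      r n ℚ.* r n ℚ.+ (M ℚ.* (1ℚ ℚ.* 1ℚ) ℚ.- M)
        ≡⟨ cong (λ z → r n ℚ.* r n ℚ.+ (z ℚ.- M)) (ℚ.*-identityʳ M) ⟩
      r n ℚ.* r n ℚ.+ (M ℚ.- M)
        ≡⟨ cong (r n ℚ.* r n ℚ.+_) (ℚ.+-inverseʳ M) ⟩
      r n ℚ.* r n ℚ.+ 0ℚ
        ≡⟨ ℚ.+-identityʳ (r n ℚ.* r n) ⟩
      r n ℚ.* r n ∎
      where
      open ≡.≡-Reasoning
      open +-*-Solver
      pell : P n ℚ.* P n ≡ 1ℚ ℚ.+ M ℚ.* (Q n ℚ.* Q n)
      pell = trans (sym (fromℕ-* (p n) (p n)))
        (trans (cong fromℕ (p²≡1+mq² n))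
        (trans (fromℤ-+ (+ 1) (+ (m ℕ.* (q n ℕ.* q n))))
        (cong (1ℚ ℚ.+_) (trans (fromℕ-* m (q n ℕ.* q n)) (cong (M ℚ.*_) (fromℕ-* (q n) (q n)))))))
      regroup : ∀ p r m → (p ℚ.* r) ℚ.* (p ℚ.* r) ℚ.- m ≡ p ℚ.* p ℚ.* (r ℚ.* r) ℚ.- m
      regroup = solve 3 (λ p r m → (p :* r) :* (p :* r) :- m := p :* p :* (r :* r) :- m) refl
      expand : ∀ m q r → (1ℚ ℚ.+ m ℚ.* (q ℚ.* q)) ℚ.* (r ℚ.* r) ℚ.- m
             ≡ r ℚ.* r ℚ.+ (m ℚ.* ((q ℚ.* r) ℚ.* (q ℚ.* r)) ℚ.- m)
      expand = solve 3 (λ m q r → (con 1ℚ :+ m :* (q :* q)) :* (r :* r) :- m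
             := r :* r :+ (m :* ((q :* r) :* (q :* r)) :- m)) refl

    -- The error r² is at most r = 1/q because r ≤ 1, and 1/q < ε as soon as q ε > 1; the
    -- Archimedean bound applies to q because `q n` exceeds n.
    s²→M : ∀ ε → 0ℚ ℚ.< ε → ∃[ N ] ∀ n → N ℕ.≤ n → ℚ.∣ s n ℚ.* s n ℚ.- M ∣ ℚ.< ε
    s²→M ε 0<ε with archimedean ε 0<ε
    ... | N , 1<nε = N , λ n N≤n → begin-strict
      ℚ.∣ s n ℚ.* s n ℚ.- M ∣  ≡⟨ cong ℚ.∣_∣ (error n) ⟩
      ℚ.∣ r n ℚ.* r n ∣        ≡⟨ ℚ.0≤p⇒∣p∣≡p (ℚ.<⇒≤ (*-pos (r n) (r n) (0<r n) (0<r n))) ⟩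
      r n ℚ.* r n              ≤⟨ ℚ.*-monoˡ-≤-nonNeg (r n) {{ℚ.pos⇒nonNeg (r n) {{r-pos n}}}} (r≤1 n) ⟩
      r n ℚ.* 1ℚ               <⟨ ℚ.*-monoʳ-<-pos (r n) {{r-pos n}} (1<nε (q n) (ℕ.≤-trans N≤n (ℕ.<⇒≤ (n<q n)))) ⟩
      r n ℚ.* (Q n ℚ.* ε)      ≡⟨ ℚ.*-assoc (r n) (Q n) ε ⟨
      (r n ℚ.* Q n) ℚ.* ε      ≡⟨ cong (ℚ._* ε) (trans (ℚ.*-comm (r n) (Q n)) (Q*r≡1 n)) ⟩
      1ℚ ℚ.* ε                 ≡⟨ ℚ.*-identityˡ ε ⟩
      ε                        ∎
      where
      open ℚ.≤-Reasoning
      0<r : ∀ n → 0ℚ ℚ.< r n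
      0<r n = ℚ.positive⁻¹ (r n) {{r-pos n}}

  √m : ℝ
  √m = sqrtLimit s M 1≤s s²→M

  √m² : √m *ᴿ √m ≈ᴿ fromℚ M
  √m² = sqrtLimit² s M 1≤s s²→M

-- Quadratic extensions and their evaluation

-- A[s] / (s² - p s - q); the pair (a , b) stands for a + b s.
quadratic : (A : RawRing 0ℓ 0ℓ) (p q : RawRing.Carrier A) → RawRing 0ℓ 0ℓ
quadratic A p q = record
  { Carrier = Carrier × Carrier
  ; _≈_ = _≡_
  ; _+_ = λ (a , b) (c , d) → a + c , b + d
  ; _*_ = λ (a , b) (c , d) → a * c + b * d * q , a * d + b * c + b * d * p
  ; -_  = λ (a , b) → - a , - b
  ; 0#  = 0# , 0#
  ; 1#  = 1# , 0#
  }
  where open RawRing A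

module Evaluation (R : CommutativeRing 0ℓ 0ℓ) where
  open CommutativeRing R renaming (refl to ≈-refl; sym to ≈-sym; trans to ≈-trans)
  open import Relation.Binary.Reasoning.Setoid setoid
  open SemiringSolver commutativeSemiring
  open SemiringSum semiring

  -- For α = (√3 + √7)/2 this is α (α - √3) = (7 - 3)/4 = 1. Subtraction is avoided so that only
  -- semiring identities occur, and `h` with `h + h ≈ 1#` plays the part of one half.
  halfSum² : ∀ {h s t} → h + h ≈ 1# → s * s ≈ 1# + 1# + 1# → t * t ≈ (1# + 1# + 1#) + (1# + 1# + 1#) + 1# →
             (h * (s + t)) * (h * (s + t)) ≈ s * (h * (s + t)) + 1#
  halfSum² {h} {s} {t} 2h≈1 s²≈3 t²≈7 = begin
    (h * (s + t)) * (h * (s + t))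
      ≈⟨ solve 3 (λ h s t → (h :* (s :+ t)) :* (h :* (s :+ t))
           := h :* h :* (s :* s :+ t :* t :+ (s :* t :+ s :* t))) ≈-refl h s t ⟩
    h * h * (s * s + t * t + (s * t + s * t))
      ≈⟨ *-congˡ (+-congʳ (+-cong s²≈3 t²≈7)) ⟩
    h * h * (three + (three + three + 1#) + (s * t + s * t))
      -- Since 10 + 2u = 2(3 + u) + 4, all factors `h` but one can be paired into `h + h`.
      ≈⟨ solve 2 (λ h u → h :* h :* (three′ :+ (three′ :+ three′ :+ con 1) :+ (u :+ u))
           := (h :+ h) :* (h :* (three′ :+ u)) :+ (h :+ h) :* (h :+ h)) ≈-refl h (s * t) ⟩
    (h + h) * (h * (three + s * t)) + (h + h) * (h + h)
      ≈⟨ +-cong (*-congʳ 2h≈1) (*-cong 2h≈1 2h≈1) ⟩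
    1# * (h * (three + s * t)) + 1# * 1#
      ≈⟨ +-cong (*-identityˡ _) (*-identityˡ 1#) ⟩
    h * (three + s * t) + 1#
      ≈⟨ +-congʳ (*-congˡ (+-congʳ s²≈3)) ⟨
    h * (s * s + s * t) + 1#
      ≈⟨ solve 3 (λ h s t → h :* (s :* s :+ s :* t) :+ con 1 := s :* (h :* (s :+ t)) :+ con 1) ≈-refl h s t ⟩
    s * (h * (s + t)) + 1# ∎
    where
    three = 1# + 1# + 1#
    three′ : ∀ {n} → Polynomial n
    three′ = con 1 :+ con 1 :+ con 1

  IsEvaluation : (A : RawRing 0ℓ 0ℓ) → (RawRing.Carrier A → Carrier) → Set
  IsEvaluation A φ =
    IsSemiringHomomorphism (record (RawRing.rawSemiring A) {_≈_ = _≡_}) (Semiring.rawSemiring semiring) φ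

  module _ (A : RawRing 0ℓ 0ℓ) {φ : RawRing.Carrier A → Carrier} (φ-hom : IsEvaluation A φ) where
    private
      module A = RawRing A
      module φ = IsSemiringHomomorphism φ-hom
      ∑ᴬ : ∀ {n} → Vector A.Carrier n → A.Carrier
      ∑ᴬ = Sum.sum A.+-rawMonoid

    pureQuadratic : ∀ {s t} → s * s ≈ t → s * s ≈ φ A.0# * s + t
    pureQuadratic {s} {t} s²≈t = begin
      s * s           ≈⟨ s²≈t ⟩
      t               ≈⟨ +-identityˡ t ⟨
      0# + t          ≈⟨ +-congʳ (≈-trans (*-congʳ φ.0#-homo) (zeroˡ s)) ⟨
      φ A.0# * s + t  ∎

    evalConstant : ∀ a {s} → φ a + φ A.0# * s ≈ φ a
    evalConstant a {s} = ≈-trans (+-congˡ (≈-trans (*-congʳ φ.0#-homo) (zeroˡ s))) (+-identityʳ (φ a))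

    module _ (p q : A.Carrier) {s : Carrier} (s² : s * s ≈ φ p * s + φ q) where
      evalQuadratic : A.Carrier × A.Carrier → Carrier
      evalQuadratic (a , b) = φ a + φ b * s

      evalQuadratic-isEvaluation : IsEvaluation (quadratic A p q) evalQuadratic
      evalQuadratic-isEvaluation = record
        { isNearSemiringHomomorphism = record
          { +-isMonoidHomomorphism = record
            { isMagmaHomomorphism = record
              { isRelHomomorphism = record { cong = reflexive ∘ cong evalQuadratic }
              ; homo = λ (a , b) (c , d) → begin
                  φ (a A.+ c) + φ (b A.+ d) * s
                    ≈⟨ +-cong (φ.+-homo a c) (*-congʳ (φ.+-homo b d)) ⟩
                  (φ a + φ c) + (φ b + φ d) * s
                    ≈⟨ solve 5 (λ a b c d s → (a :+ c) :+ (b :+ d) :* s := (a :+ b :* s) :+ (c :+ d :* s))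
                         ≈-refl (φ a) (φ b) (φ c) (φ d) s ⟩
                  (φ a + φ b * s) + (φ c + φ d * s) ∎
              }
            ; ε-homo = begin
                φ A.0# + φ A.0# * s  ≈⟨ +-cong φ.0#-homo (*-congʳ φ.0#-homo) ⟩
                0# + 0# * s          ≈⟨ +-identityˡ (0# * s) ⟩
                0# * s               ≈⟨ zeroˡ s ⟩
                0#                   ∎
            }
          ; *-homo = λ (a , b) (c , d) → begin
              φ (a A.* c A.+ b A.* d A.* q) + φ (a A.* d A.+ b A.* c A.+ b A.* d A.* p) * s
                ≈⟨ +-cong (φ-sum₂ a c b d q) (*-congʳ
                     (≈-trans (φ.+-homo (a A.* d A.+ b A.* c) (b A.* d A.* p))
                            (+-cong (≈-trans (φ.+-homo _ _) (+-cong (φ.*-homo a d) (φ.*-homo b c)))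
                                    (φ-product₃ b d p)))) ⟩
              (φ a * φ c + φ b * φ d * φ q) + ((φ a * φ d + φ b * φ c) + φ b * φ d * φ p) * s
                ≈⟨ solve 7 (λ a b c d p q s →
                     (a :* c :+ b :* d :* q) :+ ((a :* d :+ b :* c) :+ b :* d :* p) :* s
                     := a :* c :+ (a :* d :+ b :* c) :* s :+ b :* d :* (p :* s :+ q))
                     ≈-refl (φ a) (φ b) (φ c) (φ d) (φ p) (φ q) s ⟩
              φ a * φ c + (φ a * φ d + φ b * φ c) * s + φ b * φ d * (φ p * s + φ q)
                -- The only place where the quadratic relation enters: the terms with both `b` and
                -- `d` have been collected into a multiple of p s + q, which is s².
                ≈⟨ +-congˡ (*-congˡ s²) ⟨
              φ a * φ c + (φ a * φ d + φ b * φ c) * s + φ b * φ d * (s * s)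
                ≈⟨ solve 5 (λ a b c d s →
                     a :* c :+ (a :* d :+ b :* c) :* s :+ b :* d :* (s :* s)
                     := (a :+ b :* s) :* (c :+ d :* s))
                     ≈-refl (φ a) (φ b) (φ c) (φ d) s ⟩
              (φ a + φ b * s) * (φ c + φ d * s) ∎
          }
        ; 1#-homo = begin
            φ A.1# + φ A.0# * s  ≈⟨ +-cong φ.1#-homo (*-congʳ φ.0#-homo) ⟩
            1# + 0# * s          ≈⟨ +-congˡ (zeroˡ s) ⟩
            1# + 0#              ≈⟨ +-identityʳ 1# ⟩
            1#                   ∎
        }
        where
        φ-product₃ : ∀ a b c → φ (a A.* b A.* c) ≈ φ a * φ b * φ c
        φ-product₃ a b c = ≈-trans (φ.*-homo (a A.* b) c) (*-congʳ (φ.*-homo a b))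
        φ-sum₂ : ∀ a c b d q → φ (a A.* c A.+ b A.* d A.* q) ≈ φ a * φ c + φ b * φ d * φ q
        φ-sum₂ a c b d q = ≈-trans (φ.+-homo _ _) (+-cong (φ.*-homo a c) (φ-product₃ b d q))

    φ-∑ : ∀ {n} (f : Vector A.Carrier n) → φ (∑ᴬ f) ≈ sum (φ ∘ f)
    φ-∑ {zero}  f = φ.0#-homo
    φ-∑ {suc n} f = ≈-trans (φ.+-homo _ _) (+-congˡ (φ-∑ (f ∘ suc)))

    φ-eigenpair : ∀ {n} (f : Vector A.Carrier n) μ y → ∑ᴬ f ≡ μ A.* y → sum (λ i → φ (f i)) ≈ φ μ * φ y
    φ-eigenpair f μ y eq = ≈-trans (≈-sym (φ-∑ f)) (≈-trans (reflexive (cong φ eq)) (φ.*-homo μ y))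

    -- A divisor of an invertible element is invertible. It is applied with `w` the product of the
    -- other conjugates of `z`, so that `u` is an integer.
    φ-invertible : ∀ z w {u r} → φ (z A.* w) ≈ u → u * r ≈ 1# → ∃[ r ] φ z * r ≈ 1#
    φ-invertible z w {u} {r} zw≈u ur≈1 = φ w * r , (begin
      φ z * (φ w * r)  ≈⟨ *-assoc (φ z) (φ w) r ⟨
      φ z * φ w * r    ≈⟨ *-congʳ (≈-trans (≈-sym (φ.*-homo z w)) zw≈u) ⟩
      u * r            ≈⟨ ur≈1 ⟩
      1#               ∎)

    ⟨_,_⟩ : ∀ {n} → Vector A.Carrier n → Vector A.Carrier n → A.Carrier
    ⟨ x , y ⟩ = ∑ᴬ (λ i → x i A.* y i)

    sum-single : ∀ {n} (f : Vector Carrier n) k → (∀ l → l ≢ k → f l ≈ 0#) → sum f ≈ f k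
    sum-single {suc n} f k f≈0 = begin
      sum f
        ≈⟨ sum-remove f ⟩
      f k + sum (λ j → f (punchIn k j))
        ≈⟨ +-congˡ (sum-cong-≋ λ j → f≈0 (punchIn k j) (Fin.punchInᵢ≢i k j)) ⟩
      f k + sum {n} (λ _ → 0#)
        ≈⟨ +-congˡ (sum-replicate-zero n) ⟩
      f k + 0#
        ≈⟨ +-identityʳ (f k) ⟩
      f k ∎

    -- Pairing the dependency with `v k` and exchanging the two sums kills every term but c k ⟨v k,
    -- v k⟩. Over a commutative ring this can be cancelled because the squared norm is assumed
    -- invertible.
    orthogonal⇒independent : ∀ {m n} (v : Fin m → Vector A.Carrier n) →
      (∀ k l → l ≢ k → ⟨ v l , v k ⟩ ≡ A.0#) →
      (∀ k → ∃[ r ] φ ⟨ v k , v k ⟩ * r ≈ 1#) →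
      (c : Vector Carrier m) → (∀ i → sum (λ k → c k * φ (v k i)) ≈ 0#) → ∀ k → c k ≈ 0#
    orthogonal⇒independent {m} {n} v orthogonal invertible c dependent k =
      let r , norm*r≈1 = invertible k in begin
      c k                               ≈⟨ *-identityʳ (c k) ⟨
      c k * 1#                          ≈⟨ *-congˡ norm*r≈1 ⟨
      c k * (φ ⟨ v k , v k ⟩ * r)       ≈⟨ *-assoc _ _ r ⟨
      c k * φ ⟨ v k , v k ⟩ * r         ≈⟨ *-congʳ coefficient≈0 ⟩
      0# * r                            ≈⟨ zeroˡ r ⟩
      0#                                ∎
      where
      φ-⟨⟩ : ∀ x y → φ ⟨ x , y ⟩ ≈ sum (λ i → φ (x i) * φ (y i))
      φ-⟨⟩ x y = ≈-trans (φ-∑ (λ i → x i A.* y i)) (sum-cong-≋ λ i → φ.*-homo (x i) (y i))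

      coefficient≈0 : c k * φ ⟨ v k , v k ⟩ ≈ 0#
      coefficient≈0 = begin
        c k * φ ⟨ v k , v k ⟩
          ≈⟨ sum-single (λ l → c l * φ ⟨ v l , v k ⟩) k (λ l l≢k →
               ≈-trans (*-congˡ (≈-trans (reflexive (cong φ (orthogonal k l l≢k))) φ.0#-homo)) (zeroʳ (c l))) ⟨
        sum (λ l → c l * φ ⟨ v l , v k ⟩)
          ≈⟨ sum-cong-≋ (λ l → ≈-trans (*-congˡ (φ-⟨⟩ (v l) (v k)))
               (*-distribˡ-sum (c l) (λ i → φ (v l i) * φ (v k i)))) ⟩
        sum (λ l → sum (λ i → c l * (φ (v l i) * φ (v k i))))
          ≈⟨ ∑-comm (λ l i → c l * (φ (v l i) * φ (v k i))) ⟩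
        sum (λ i → sum (λ l → c l * (φ (v l i) * φ (v k i))))
          ≈⟨ sum-cong-≋ (λ i → ≈-trans
               (sum-cong-≋ λ l → ≈-sym (*-assoc (c l) (φ (v l i)) (φ (v k i))))
               (≈-sym (*-distribʳ-sum (φ (v k i)) (λ l → c l * φ (v l i))))) ⟩
        sum (λ i → sum (λ l → c l * φ (v l i)) * φ (v k i))
          ≈⟨ sum-cong-≋ (λ i → ≈-trans (*-congʳ (dependent i)) (zeroˡ (φ (v k i)))) ⟩
        sum {n} (λ _ → 0#)
          ≈⟨ sum-replicate-zero n ⟩
        0# ∎

-- The ring ℤ[√3, α]

module Rᴿ = CommutativeRing ℝ-commutativeRing
open SemiringSum Rᴿ.semiring using (sum-cong-≋)
open Evaluation ℝ-commutativeRing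

fromℤᴿ : ℤ → ℝ
fromℤᴿ = fromℚ ∘ fromℤ

fromℤᴿ-isEvaluation : IsEvaluation ℤ.+-*-rawRing fromℤᴿ
fromℤᴿ-isEvaluation = record
  { isNearSemiringHomomorphism = record
    { +-isMonoidHomomorphism = record
      { isMagmaHomomorphism = record
        { isRelHomomorphism = record { cong = Rᴿ.reflexive ∘ cong fromℤᴿ }
        ; homo = λ i j → ≗⇒≈ᴿ {fromℤᴿ (i ℤ.+ j)} {fromℤᴿ i +ᴿ fromℤᴿ j} λ _ → fromℤ-+ i j
        }
      ; ε-homo = Rᴿ.refl {0ᴿ}
      }
    ; *-homo = λ i j → ≗⇒≈ᴿ {fromℤᴿ (i ℤ.* j)} {fromℤᴿ i *ᴿ fromℤᴿ j} λ _ → fromℤ-* i j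
    }
  ; 1#-homo = Rᴿ.refl {1ᴿ}
  }

-- The arguments are the fundamental solutions 2² = 1 + 3 · 1² and 8² = 1 + 7 · 3² of the two Pell
-- equations.
√3 √7 α : ℝ
√3 = Pell.√m 2 1 3 refl
√7 = Pell.√m 8 3 7 refl
α = fromℚ ½ *ᴿ (√3 +ᴿ √7)

ℤ[√3] ℤ[√3,α] : RawRing 0ℓ 0ℓ
ℤ[√3]   = quadratic ℤ.+-*-rawRing 0ℤ (+ 3)
ℤ[√3,α] = quadratic ℤ[√3] (0ℤ , 1ℤ) (1ℤ , 0ℤ)

open RawRing ℤ[√3,α] using ()
  renaming (Carrier to K; _+_ to _+ᴷ_; _*_ to _*ᴷ_; -_ to -ᴷ_; 0# to 0ᴷ; 1# to 1ᴷ)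

√3² : √3 *ᴿ √3 ≈ᴿ fromℤᴿ 0ℤ *ᴿ √3 +ᴿ fromℤᴿ (+ 3)
√3² = pureQuadratic ℤ.+-*-rawRing fromℤᴿ-isEvaluation {√3} {fromℤᴿ (+ 3)}
  (Pell.√m² 2 1 3 refl)

eval₁ : ℤ × ℤ → ℝ
eval₁ = evalQuadratic ℤ.+-*-rawRing fromℤᴿ-isEvaluation 0ℤ (+ 3) {√3} √3²

eval₁-isEvaluation : IsEvaluation ℤ[√3] eval₁
eval₁-isEvaluation = evalQuadratic-isEvaluation ℤ.+-*-rawRing fromℤᴿ-isEvaluation 0ℤ (+ 3) {√3} √3²

α² : α *ᴿ α ≈ᴿ eval₁ (0ℤ , 1ℤ) *ᴿ α +ᴿ eval₁ (1ℤ , 0ℤ)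
α² = begin
  α *ᴿ α
    ≈⟨ halfSum² {fromℚ ½} {√3} {√7}
         (≗⇒≈ᴿ {fromℚ ½ +ᴿ fromℚ ½} {1ᴿ} λ _ → refl)
         (Pell.√m² 2 1 3 refl)
         (Pell.√m² 8 3 7 refl) ⟩
  √3 *ᴿ α +ᴿ 1ᴿ
    ≈⟨ ≗⇒≈ᴿ {√3 *ᴿ α +ᴿ 1ᴿ} {eval₁ (0ℤ , 1ℤ) *ᴿ α +ᴿ eval₁ (1ℤ , 0ℤ)}
         (λ n → coefficients (seq √3 n) (seq α n)) ⟩
  eval₁ (0ℤ , 1ℤ) *ᴿ α +ᴿ eval₁ (1ℤ , 0ℤ) ∎
  where
  open import Relation.Binary.Reasoning.Setoid Rᴿ.setoid
  open +-*-Solver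
  coefficients : ∀ s a → s ℚ.* a ℚ.+ 1ℚ ≡ (0ℚ ℚ.+ 1ℚ ℚ.* s) ℚ.* a ℚ.+ (1ℚ ℚ.+ 0ℚ ℚ.* s)
  coefficients = solve 2 (λ s a → s :* a :+ con 1ℚ
    := (con 0ℚ :+ con 1ℚ :* s) :* a :+ (con 1ℚ :+ con 0ℚ :* s)) refl

eval : K → ℝ
eval = evalQuadratic ℤ[√3] eval₁-isEvaluation (0ℤ , 1ℤ) (1ℤ , 0ℤ) {α} α²

eval-isEvaluation : IsEvaluation ℤ[√3,α] eval
eval-isEvaluation = evalQuadratic-isEvaluation ℤ[√3] eval₁-isEvaluation (0ℤ , 1ℤ) (1ℤ , 0ℤ) {α} α²

∑ᴷ : ∀ {n} → Vector K n → K
∑ᴷ = Sum.sum (RawRing.+-rawMonoid ℤ[√3,α])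

infix 4 _≟ᴷ_

-- Unlike ≡-dec, this does not match on the equality proofs of components,
-- which for integers are as large as the integers themselves.
_≟ᴷ_ : DecidableEquality K
((a , b) , (c , d)) ≟ᴷ ((a′ , b′) , (c′ , d′)) = map′
  (λ { ((refl , refl) , (refl , refl)) → refl })
  (λ { refl → (refl , refl) , (refl , refl) })
  ((a ℤ.≟ a′ ×-dec b ℤ.≟ b′) ×-dec (c ℤ.≟ c′ ×-dec d ℤ.≟ d′))

fromℤᴷ : ℤ → K
fromℤᴷ i = (i , 0ℤ) , (0ℤ , 0ℤ)

-- The product of the other conjugates of z over ℚ: z * cofactor z is the
-- norm of z.
cofactor : K → K
cofactor z@(a , b) = conjugate *ᴷ ((proj₁ relativeNorm , ℤ.- proj₂ relativeNorm) , (0ℤ , 0ℤ))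
  where
  open RawRing ℤ[√3] using (_+_; _*_; -_)
  -- Over ℚ(√3) the conjugate of α is √3 - α, so a + b α goes to (a + √3 b) - b α. The product with
  -- z then lies in ℤ[√3], where conjugation changes the sign of the √3 part.
  conjugate = a + (0ℤ , 1ℤ) * b , - b
  relativeNorm = proj₁ (z *ᴷ conjugate)

norm : K → ℤ
norm z = proj₁ (proj₁ (z *ᴷ cofactor z))

eval-fromℤᴷ : ∀ i → eval (fromℤᴷ i) ≈ᴿ fromℤᴿ i
eval-fromℤᴷ i = Rᴿ.trans {eval (fromℤᴷ i)} {eval₁ (i , 0ℤ)} {fromℤᴿ i}
  (evalConstant ℤ[√3] eval₁-isEvaluation (i , 0ℤ) {α})
  (evalConstant ℤ.+-*-rawRing fromℤᴿ-isEvaluation i {√3})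

fromℤᴿ-invertible : ∀ d → d ≢ 0ℤ → ∃[ r ] fromℤᴿ d *ᴿ r ≈ᴿ 1ᴿ
fromℤᴿ-invertible d d≢0 =
  fromℚ (ℚ.1/ fromℤ d) , ≗⇒≈ᴿ {fromℤᴿ d *ᴿ fromℚ (ℚ.1/ fromℤ d)} {1ᴿ} λ _ → ℚ.*-inverseʳ (fromℤ d)
  where
  instance
    fromℤd-nonZero : ℚ.NonZero (fromℤ d)
    fromℤd-nonZero = ℚ.≢-nonZero {fromℤ d} (d≢0 ∘ cong ℚ.numerator)

norm-invertible : ∀ z w d → z *ᴷ w ≡ fromℤᴷ d → d ≢ 0ℤ → ∃[ r ] eval z *ᴿ r ≈ᴿ 1ᴿ
norm-invertible z w d zw≡d d≢0 =
  let r , dr≈1 = fromℤᴿ-invertible d d≢0 in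
  φ-invertible ℤ[√3,α] eval-isEvaluation z w {fromℤᴿ d} {r}
    (subst (λ x → eval x ≈ᴿ fromℤᴿ d) (sym zw≡d) (eval-fromℤᴷ d)) dr≈1

-- Stated for an arbitrary evaluation e: unfolding a concrete one makes the
-- conversion checker compare Cauchy moduli.
orthogonal⇒isSpectrum : (A : RawRing 0ℓ 0ℓ) (let open RawRing A) {e : Carrier → ℝ} →
  IsEvaluation A e →
  (let ⟨_,_⟩ = λ {n} (x y : Vector Carrier n) → Sum.sum +-rawMonoid (λ i → x i * y i)) →
  ∀ {n} (G : BipartiteGraph n) (μ : Vector Carrier n) (v : Fin n → Vector Carrier n) →
  (∀ k i → Sum.sum +-rawMonoid (λ j → if BipartiteGraph.adj G i j then v k j else 0#) ≡ μ k * v k i) →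
  (∀ k l → l ≢ k → ⟨ v l , v k ⟩ ≡ 0#) →
  (∀ k → ∃[ r ] e ⟨ v k , v k ⟩ *ᴿ r ≈ᴿ 1ᴿ) →
  IsSpectrum G (λ k → e (μ k))
orthogonal⇒isSpectrum A {e} e-hom {n} G μ v eigenvectors orthogonal invertible =
  (λ k i → e (v k i)) , eigenpair , orthogonal⇒independent A e-hom v orthogonal invertible
  where
  module e = IsSemiringHomomorphism e-hom

  entry : ∀ b x → (if b then 1ᴿ else 0ᴿ) *ᴿ e x ≈ᴿ e (if b then x else RawRing.0# A)
  entry true  x = ≗⇒≈ᴿ {1ᴿ *ᴿ e x} {e x} λ n → ℚ.*-identityˡ (seq (e x) n)
  entry false x = Rᴿ.trans {0ᴿ *ᴿ e x} {0ᴿ} {e (RawRing.0# A)} (Rᴿ.zeroˡ (e x))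
    (Rᴿ.sym {e (RawRing.0# A)} {0ᴿ} e.0#-homo)

  eigenpair : ∀ k → IsEigenpair (adjacencyMatrix G) (e (μ k)) (λ i → e (v k i))
  eigenpair k i = Rᴿ.trans
    {sumᴿ (λ j → adjacencyMatrix G i j *ᴿ e (v k j))}
    {sumᴿ (λ j → e (if BipartiteGraph.adj G i j then v k j else RawRing.0# A))}
    {e (μ k) *ᴿ e (v k i)}
    (sum-cong-≋ {n} {λ j → adjacencyMatrix G i j *ᴿ e (v k j)}
      {λ j → e (if BipartiteGraph.adj G i j then v k j else RawRing.0# A)}
      (λ j → entry (BipartiteGraph.adj G i j) (v k j)))
    (φ-eigenpair A e-hom (λ j → if BipartiteGraph.adj G i j then v k j else RawRing.0# A)
      (μ k) (v k i) (eigenvectors k i))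

-- Counting cycles by depth-first search

length-filter-map : {A B : Set} {P : Pred B 0ℓ} (P? : Decidable P) (f : A → B) →
                    ∀ xs → length (filter P? (map f xs)) ≡ length (filter (P? ∘ f) xs)
length-filter-map P? f []       = refl
length-filter-map P? f (x ∷ xs) with does (P? (f x))
... | true  = cong suc (length-filter-map P? f xs)
... | false = length-filter-map P? f xs

module _ {A : Set} where

  length-filter-≐ : {P Q : Pred A 0ℓ} (P? : Decidable P) (Q? : Decidable Q) → P ≐ Q →
                    ∀ xs → length (filter P? xs) ≡ length (filter Q? xs)
  length-filter-≐ P? Q? P≐Q xs = cong length (filter-≐ P? Q? P≐Q xs)

  length-filter-∅ : {P : Pred A 0ℓ} (P? : Decidable P) → (∀ x → ¬ P x) →
                    ∀ xs → length (filter P? xs) ≡ 0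
  length-filter-∅ P? ¬P xs = cong length (filter-none P? (All.universal ¬P xs))

  sum-map-filter : {P : Pred A 0ℓ} (P? : Decidable P) {f g : A → ℕ} →
                   (∀ x → ¬ P x → f x ≡ 0) → (∀ x → P x → f x ≡ g x) →
                   ∀ xs → sumᴺ (map f xs) ≡ sumᴺ (map g (filter P? xs))
  sum-map-filter P? f≡0 f≡g []       = refl
  sum-map-filter P? f≡0 f≡g (x ∷ xs) with P? x
  ... | yes Px = cong₂ ℕ._+_ (f≡g x Px) (sum-map-filter P? f≡0 f≡g xs)
  ... | no ¬Px = cong₂ ℕ._+_ (f≡0 x ¬Px) (sum-map-filter P? f≡0 f≡g xs)

  -- Splitting the count by the first entry is what allows a whole branch of the enumeration to be
  -- dropped once its prefix is inadmissible.
  length-filter-tuples : {P : Pred (List A) 0ℓ} (P? : Decidable P) → ∀ xs k →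
    length (filter P? (tuples xs (suc k))) ≡
    sumᴺ (map (λ x → length (filter (P? ∘ (x ∷_)) (tuples xs k))) xs)
  length-filter-tuples P? xs k = go xs
    where
    go : ∀ ys → length (filter P? (cartesianProductWith _∷_ ys (tuples xs k))) ≡
                sumᴺ (map (λ y → length (filter (P? ∘ (y ∷_)) (tuples xs k))) ys)
    go []       = refl
    go (y ∷ ys) = begin
      length (filter P? (map (y ∷_) (tuples xs k) ++ rest))
        ≡⟨ cong length (filter-++ P? (map (y ∷_) (tuples xs k)) rest) ⟩
      length (filter P? (map (y ∷_) (tuples xs k)) ++ filter P? rest)
        ≡⟨ length-++ (filter P? (map (y ∷_) (tuples xs k))) ⟩
      length (filter P? (map (y ∷_) (tuples xs k))) ℕ.+ length (filter P? rest)
        ≡⟨ cong₂ ℕ._+_ (length-filter-map P? (y ∷_) (tuples xs k)) (go ys) ⟩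
      length (filter (P? ∘ (y ∷_)) (tuples xs k)) ℕ.+ _ ∎
      where
      open ≡.≡-Reasoning
      rest = cartesianProductWith _∷_ ys (tuples xs k)

module DepthFirst {n : ℕ} (G : BipartiteGraph n) where
  open BipartiteGraph G using (adj)

  neighbours : Fin n → List (Fin n)
  neighbours u = filter (λ v → T? (adj u v)) (allFin n)

  -- ws continues a path s h … u to a canonical cycle, where free marks the
  -- vertices that are not on the path and larger than s.
  Closes : (s h u : Fin n) → Vec Bool n → List (Fin n) → Set
  Closes s h u free []       = Adj G u s × h Fin.< u
  Closes s h u free (w ∷ ws) =
    Adj G u w × T (lookup free w) × Closes s h w (free [ w ]≔ false) ws

  closes? : ∀ s h u free → Decidable (Closes s h u free)
  closes? s h u free []       = T? (adj u s) ×-dec h Fin.<? u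
  closes? s h u free (w ∷ ws) =
    T? (adj u w) ×-dec T? (lookup free w) ×-dec closes? s h w (free [ w ]≔ false) ws

  -- The table of neighbour lists is a parameter so that the type checker
  -- evaluates it only once.
  countClosing : Vec (List (Fin n)) n → ℕ → (s h u : Fin n) → Vec Bool n → ℕ
  countClosing nbrs zero    s h u free = if does (T? (adj u s) ×-dec h Fin.<? u) then 1 else 0
  countClosing nbrs (suc k) s h u free =
    sumᴺ (map (λ w → if lookup free w then countClosing nbrs k s h w (free [ w ]≔ false) else 0)
             (lookup nbrs u))

  above : Fin n → Vec Bool n
  above s = tabulate λ w → does (s Fin.<? w)

  -- Here `k` is the number of vertices after the first two, so the cycles counted have length k +
  -- 2.
  countCanonical : Vec (List (Fin n)) n → ℕ → ℕ
  countCanonical nbrs k =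
    sumᴺ (map (λ s → sumᴺ (map (λ h →
      if does (s Fin.<? h) then countClosing nbrs k s h h (above s [ h ]≔ false) else 0)
      (lookup nbrs s))) (allFin n))

  sum-neighbours : ∀ u {f g : Fin n → ℕ} →
    (∀ w → ¬ Adj G u w → f w ≡ 0) → (∀ w → Adj G u w → f w ≡ g w) →
    sumᴺ (map f (allFin n)) ≡ sumᴺ (map g (lookup (tabulate neighbours) u))
  sum-neighbours u {g = g} f≡0 f≡g = trans
    (sum-map-filter (λ w → T? (adj u w)) f≡0 f≡g (allFin n))
    (cong (sumᴺ ∘ map g) (sym (lookup∘tabulate neighbours u)))

  length-closes : ∀ k s h u free →
    length (filter (closes? s h u free) (tuples (allFin n) k)) ≡
    countClosing (tabulate neighbours) k s h u free
  length-closes zero    s h u free with does (T? (adj u s) ×-dec h Fin.<? u)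
  ... | true  = refl
  ... | false = refl
  length-closes (suc k) s h u free = trans
    (length-filter-tuples (closes? s h u free) (allFin n) k)
    (sum-neighbours u
      (λ w ¬uw → length-filter-∅ (closes? s h u free ∘ (w ∷_)) (λ _ → ¬uw ∘ proj₁) (tuples (allFin n) k))
      (λ w uw → branch w uw (lookup free w) refl))
    where
    branch : ∀ w → Adj G u w → ∀ b → lookup free w ≡ b →
      length (filter (closes? s h u free ∘ (w ∷_)) (tuples (allFin n) k)) ≡
      (if b then countClosing (tabulate neighbours) k s h w (free [ w ]≔ false) else 0)
    branch w uw true  w-free = trans
      (length-filter-≐ (closes? s h u free ∘ (w ∷_)) (closes? s h w (free [ w ]≔ false))
        (proj₂ ∘ proj₂ , λ c → uw , subst T (sym w-free) _ , c) (tuples (allFin n) k))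
      (length-closes k s h w (free [ w ]≔ false))
    branch w uw false w-used =
      length-filter-∅ (closes? s h u free ∘ (w ∷_)) (λ _ (_ , w-free , _) → subst T w-used w-free)
        (tuples (allFin n) k)

  Free : Vec Bool n → Fin n → Set
  Free free w = T (lookup free w)

  free-update : ∀ free w {v} → w ≢ v → Free free v → Free (free [ w ]≔ false) v
  free-update free w w≢v = subst T (sym (lookup∘update′ (w≢v ∘ sym) free false))

  update-free : ∀ free w {v} → Free (free [ w ]≔ false) v → w ≢ v × Free free v
  update-free free w {v} v-free = w≢v , subst T (lookup∘update′ (w≢v ∘ sym) free false) v-free
    where
    w≢v : w ≢ v
    w≢v refl = subst T (lookup∘update w free false) v-free

  -- Clearing w in `free` before the walk goes on forces all later vertices to differ from w;
  -- accumulated along the walk, this is `Unique`.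
  Closes⇒ : ∀ s h u free ws → Closes s h u free ws →
    Linked (Adj G) (u ∷ ws ++ [ s ]) × All (Free free) ws × Unique ws ×
    Connected Fin._<_ (just h) (last (u ∷ ws))
  Closes⇒ s h u free []       (us , h<u) = us ∷ [-] , [] , [] , just h<u
  Closes⇒ s h u free (w ∷ ws) (uw , w-free , c) =
    let linked , ws-free , unique , h<last = Closes⇒ s h w (free [ w ]≔ false) ws c
    in  uw ∷ linked
      , w-free ∷ All.map (proj₂ ∘ update-free free w) ws-free
      , All.map (proj₁ ∘ update-free free w) ws-free ∷ unique
      , h<last

  ⇒Closes : ∀ s h u free ws →
    Linked (Adj G) (u ∷ ws ++ [ s ]) → All (Free free) ws → Unique ws →
    Connected Fin._<_ (just h) (last (u ∷ ws)) → Closes s h u free ws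
  ⇒Closes s h u free []       (us ∷ _) _ _ h<u = us , drop-just h<u
  ⇒Closes s h u free (w ∷ ws) (uw ∷ linked) (w-free ∷ ws-free) (w∉ws ∷ unique) h<last =
    uw , w-free ,
    ⇒Closes s h w (free [ w ]≔ false) ws linked
      (All.zipWith (λ (w≢v , v-free) → free-update free w w≢v v-free) (w∉ws , ws-free)) unique h<last

  above⇒< : ∀ s {w} → Free (above s) w → s Fin.< w
  above⇒< s {w} = ℕ.<ᵇ⇒< _ _ ∘ subst T (lookup∘tabulate (λ w → does (s Fin.<? w)) w)

  <⇒above : ∀ s {w} → s Fin.< w → Free (above s) w
  <⇒above s {w} = subst T (sym (lookup∘tabulate (λ w → does (s Fin.<? w)) w)) ∘ ℕ.<⇒<ᵇ

  CanonicalCycle : List (Fin n) → Set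
  CanonicalCycle vs = IsCycle G vs × Canonical vs

  canonicalCycle? : Decidable CanonicalCycle
  canonicalCycle? vs = isCycle? G vs ×-dec canonical? vs

  canonicalCycle⇒closes : ∀ {s h} vs → CanonicalCycle (s ∷ h ∷ vs) →
    Adj G s h × s Fin.< h × Closes s h h (above s [ h ]≔ false) vs
  canonicalCycle⇒closes {s} {h} vs
    ((_ , _ ∷ (h∉vs ∷ unique) , sh ∷ linked) , s<h ∷ s<vs , h<last) =
    sh , s<h , ⇒Closes s h h (above s [ h ]≔ false) vs linked
      (All.zipWith (λ (h≢v , s<v) → free-update (above s) h h≢v (<⇒above s s<v)) (h∉vs , s<vs))
      unique h<last

  closes⇒canonicalCycle : ∀ {s h} vs → Adj G s h → s Fin.< h →
    Closes s h h (above s [ h ]≔ false) vs → CanonicalCycle (s ∷ h ∷ vs)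
  closes⇒canonicalCycle {s} {h} vs sh s<h c =
    let linked , vs-free , unique , h<last = Closes⇒ s h h (above s [ h ]≔ false) vs c
        s<vs = All.map (above⇒< s ∘ proj₂ ∘ update-free (above s) h) vs-free
        h∉vs = All.map (proj₁ ∘ update-free (above s) h) vs-free
    in  ( 3≤length vs h<last
        , All.map (λ s<v → λ { refl → Fin.<-irrefl refl s<v }) (s<h ∷ s<vs) ∷ (h∉vs ∷ unique)
        , sh ∷ linked)
      , s<h ∷ s<vs
      , h<last
    where
    -- Without a third vertex, h would be both neighbours of s on the cycle, and the canonical
    -- direction would demand h < h.
    3≤length : ∀ vs → Connected Fin._<_ (just h) (last (h ∷ vs)) → 3 ℕ.≤ length (s ∷ h ∷ vs)
    3≤length []       h<h = contradiction (drop-just h<h) (Fin.<-irrefl refl)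
    3≤length (_ ∷ _)  _   = s≤s (s≤s (s≤s z≤n))

  cycleCount : ℕ → ℕ
  cycleCount = countCanonical (tabulate neighbours)

  numCycles≡cycleCount : ∀ k → numCycles G (suc (suc k)) ≡ cycleCount k
  numCycles≡cycleCount k = trans
    (length-filter-tuples canonicalCycle? (allFin n) (suc k))
    (cong sumᴺ (map-cong (λ s → trans
      (length-filter-tuples (canonicalCycle? ∘ (s ∷_)) (allFin n) k)
      (sum-neighbours s (notAdjacent s) (λ h sh → branch s h sh (s Fin.<? h)))) (allFin n)))
    where
    notAdjacent : ∀ s h → ¬ Adj G s h →
      length (filter (canonicalCycle? ∘ (s ∷_) ∘ (h ∷_)) (tuples (allFin n) k)) ≡ 0
    notAdjacent s h ¬sh = length-filter-∅ (canonicalCycle? ∘ (s ∷_) ∘ (h ∷_))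
      (λ vs → ¬sh ∘ proj₁ ∘ canonicalCycle⇒closes vs) (tuples (allFin n) k)

    branch : ∀ s h → Adj G s h → (s<h? : Dec (s Fin.< h)) →
      length (filter (canonicalCycle? ∘ (s ∷_) ∘ (h ∷_)) (tuples (allFin n) k)) ≡
      (if does s<h? then countClosing (tabulate neighbours) k s h h (above s [ h ]≔ false) else 0)
    branch s h sh (yes s<h) = trans
      (length-filter-≐ (canonicalCycle? ∘ (s ∷_) ∘ (h ∷_)) (closes? s h h (above s [ h ]≔ false))
        ((λ {vs} → proj₂ ∘ proj₂ ∘ canonicalCycle⇒closes vs) , λ {vs} → closes⇒canonicalCycle vs sh s<h)
        (tuples (allFin n) k))
      (length-closes k s h h (above s [ h ]≔ false))
    branch s h sh (no s≮h) = length-filter-∅ (canonicalCycle? ∘ (s ∷_) ∘ (h ∷_))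
      (λ vs → s≮h ∘ proj₁ ∘ proj₂ ∘ canonicalCycle⇒closes vs) (tuples (allFin n) k)

-- Incidence graphs and girth

module _ {m : ℕ} (incident : Fin m → Fin m → Bool) where

  joined : Fin m ⊎ Fin m → Fin m ⊎ Fin m → Bool
  joined (inj₁ p) (inj₂ l) = incident p l
  joined (inj₂ l) (inj₁ p) = incident p l
  joined _        _        = false

  isPoint : Fin m ⊎ Fin m → Bool
  isPoint = [ const true , const false ]′

  leviGraph : BipartiteGraph (m ℕ.+ m)
  leviGraph = record
    { adj        = λ u v → joined (splitAt m u) (splitAt m v)
    ; adj-sym    = λ u v → joined-sym (splitAt m u) (splitAt m v)
    ; adj-irrefl = λ u → joined-irrefl (splitAt m u)
    ; side       = λ u → isPoint (splitAt m u)
    ; bipartite  = λ u v → joined-bipartite (splitAt m u) (splitAt m v)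
    }
    where
    joined-sym : ∀ x y → joined x y ≡ joined y x
    joined-sym (inj₁ _) (inj₁ _) = refl
    joined-sym (inj₁ _) (inj₂ _) = refl
    joined-sym (inj₂ _) (inj₁ _) = refl
    joined-sym (inj₂ _) (inj₂ _) = refl

    joined-irrefl : ∀ x → joined x x ≡ false
    joined-irrefl (inj₁ _) = refl
    joined-irrefl (inj₂ _) = refl

    joined-bipartite : ∀ x y → T (joined x y) → isPoint x ≢ isPoint y
    joined-bipartite (inj₁ _) (inj₂ _) _ ()
    joined-bipartite (inj₂ _) (inj₁ _) _ ()

module _ {n : ℕ} (G : BipartiteGraph n) where
  open BipartiteGraph G

  -- Each adjacency follows directly after the vertices that it relates, so that the decision
  -- procedure abandons a non-adjacent choice at once instead of running through all quadruples.
  Quadrilateral-free : Set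
  Quadrilateral-free =
    ∀ a b → Adj G a b → ∀ c → Adj G b c → ∀ d → Adj G c d → Adj G d a → a ≡ c ⊎ b ≡ d

  quadrilateral-free? : Dec Quadrilateral-free
  quadrilateral-free? =
    Fin.all? λ a → Fin.all? λ b → T? (adj a b) →-dec Fin.all? λ c → T? (adj b c) →-dec
    Fin.all? λ d → T? (adj c d) →-dec T? (adj d a) →-dec (a Fin.≟ c ⊎-dec b Fin.≟ d)

  even-walk : ∀ a b c → Adj G a b → Adj G b c → side a ≡ side c
  even-walk a b c ab bc = two-sides (side a) (side b) (side c) (bipartite a b ab) (bipartite b c bc)
    where
    two-sides : ∀ x y z → x ≢ y → y ≢ z → x ≡ z
    two-sides false false _     x≢y _   = ⊥-elim (x≢y refl)
    two-sides true  true  _     x≢y _   = ⊥-elim (x≢y refl)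
    two-sides false true  false _   _   = refl
    two-sides true  false true  _   _   = refl
    two-sides false true  true  _   y≢z = ⊥-elim (y≢z refl)
    two-sides true  false false _   y≢z = ⊥-elim (y≢z refl)

  cycles-≥6 : Quadrilateral-free → ∀ vs → IsCycle G vs → 6 ℕ.≤ length vs
  cycles-≥6 _ (_ ∷ [])                   (s≤s () , _)
  cycles-≥6 _ (_ ∷ _ ∷ [])               (s≤s (s≤s ()) , _)
  cycles-≥6 _ (a ∷ b ∷ c ∷ [])           (_ , _ , ab ∷ bc ∷ ca ∷ _) =
    ⊥-elim (bipartite c a ca (sym (even-walk a b c ab bc)))
  cycles-≥6 quadrilateral-free (a ∷ b ∷ c ∷ d ∷ [])
    (_ , (_ ∷ a≢c ∷ _) ∷ (_ ∷ b≢d ∷ _) ∷ _ , ab ∷ bc ∷ cd ∷ da ∷ _) =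
    ⊥-elim ([ a≢c , b≢d ]′ (quadrilateral-free a b ab c bc d cd da))
  cycles-≥6 _ (a ∷ b ∷ c ∷ d ∷ e ∷ [])   (_ , _ , ab ∷ bc ∷ cd ∷ de ∷ ea ∷ _) =
    ⊥-elim (bipartite e a ea (sym (trans (even-walk a b c ab bc) (even-walk c d e cd de))))
  cycles-≥6 _ (_ ∷ _ ∷ _ ∷ _ ∷ _ ∷ _ ∷ _) _ = s≤s (s≤s (s≤s (s≤s (s≤s (s≤s z≤n)))))

-- Eigenvector tables

-- Equations between Booleans are evaluated faster than instances of T.
does-witness : {P : Set} (P? : Dec P) → does P? ≡ true → P
does-witness (yes p) _ = p

infix 7 _∙_

_∙_ : ∀ {n} → Vec K n → Vec K n → K
x ∙ y = ∑ᴷ (λ i → lookup x i *ᴷ lookup y i)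

module _ {n} (G : BipartiteGraph n) (μ : Vec K n) (v : Vec (Vec K n) n) where
  open BipartiteGraph G using (adj)

  eigenvectors? : Dec (∀ k i → ∑ᴷ (λ j → if adj i j then lookup (lookup v k) j else 0ᴷ) ≡
                               lookup μ k *ᴷ lookup (lookup v k) i)
  eigenvectors? = Fin.all? λ k → Fin.all? λ i →
    ∑ᴷ (λ j → if adj i j then lookup (lookup v k) j else 0ᴷ) ≟ᴷ lookup μ k *ᴷ lookup (lookup v k) i

  orthogonal? : Dec (∀ k l → l ≢ k → lookup v l ∙ lookup v k ≡ 0ᴷ)
  orthogonal? = Fin.all? λ k → Fin.all? λ l →
    ¬? (l Fin.≟ k) →-dec lookup v l ∙ lookup v k ≟ᴷ 0ᴷ

  -- That z times its cofactor is an integer is checked by evaluation for each z in question, which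
  -- takes the place of a general theory of conjugates.
  NonzeroNorm : K → Set
  NonzeroNorm z = z *ᴷ cofactor z ≡ fromℤᴷ (norm z) × norm z ≢ 0ℤ

  nonzeroNorm? : ∀ z → Dec (NonzeroNorm z)
  nonzeroNorm? z = z *ᴷ cofactor z ≟ᴷ fromℤᴷ (norm z) ×-dec ¬? (norm z ℤ.≟ 0ℤ)

  anisotropic? : Dec (∀ k → NonzeroNorm (lookup v k ∙ lookup v k))
  anisotropic? = Fin.all? λ k → nonzeroNorm? (lookup v k ∙ lookup v k)

  isSpectrum : does eigenvectors? ≡ true → does orthogonal? ≡ true → does anisotropic? ≡ true →
               IsSpectrum G (λ k → eval (lookup μ k))
  isSpectrum eigenvectors orthogonal anisotropic =
    orthogonal⇒isSpectrum ℤ[√3,α] eval-isEvaluation G (lookup μ) (λ k → lookup (lookup v k))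
      (does-witness eigenvectors? eigenvectors) (does-witness orthogonal? orthogonal)
      (λ k → let z = lookup v k ∙ lookup v k
                 zw≡d , d≢0 = does-witness anisotropic? anisotropic k
             in  norm-invertible z (cofactor z) (norm z) zw≡d d≢0)

√3ᴷ αᴷ ᾱᴷ : K
√3ᴷ = (0ℤ , 1ℤ) , (0ℤ , 0ℤ)
αᴷ  = (0ℤ , 0ℤ) , (1ℤ , 0ℤ)
ᾱᴷ  = √3ᴷ +ᴷ (-ᴷ αᴷ)

-- The order matches the rows of the eigenvector tables. The value `ᾱᴷ` stands for (√3 - √7)/2,
-- which is negative, but each value is used with both signs. Zero is left out because x alone does
-- not yield its eigenvectors.
singularValues : Vec K 11
singularValues =
  fromℤᴷ (+ 3) ∷ fromℤᴷ (+ 2) ∷ 1ᴷ ∷ √3ᴷ ∷ √3ᴷ ∷ √3ᴷ ∷ √3ᴷ ∷ αᴷ ∷ αᴷ ∷ ᾱᴷ ∷ ᾱᴷ ∷ []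

eigenvalues : Vec K 24
eigenvalues = (0ᴷ ∷ singularValues) Vec.++ Vec.map -ᴷ_ (0ᴷ ∷ singularValues)

incidence : Vec (List ℕ) 12 → Fin 12 → Fin 12 → Bool
incidence lines p l = Bool.any (λ i → toℕ l ℕ.≡ᵇ i) (lookup lines p)

-- If N Nᵀ x = σ² x then (σ x , ± Nᵀ x) is an eigenvector for ± σ.  The
-- eigenvectors x of N Nᵀ are integral for σ = 3, 2, 1, √3, and of the form
-- a + σ² b for σ = α, √3 - α with integral a, b shared by the two conjugates.
-- The vectors (x , ± y) with Nᵀ x = N y = 0 and |x| = |y| account for σ = 0.
eigenvectors : Vec (List ℕ) 12 → Vec ℤ 12 × Vec ℤ 12 → Vec (Vec ℤ 12) 7 →
               Vec (Vec ℤ 12 × Vec ℤ 12) 2 → Vec (Vec K 24) 24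
eigenvectors lines (kernelˡ , kernelʳ) integral conjugate = reflect
  ((Vec.map fromℤᴷ kernelˡ , Vec.map fromℤᴷ kernelʳ) ∷
   Vec.zipWith (λ σ x → Vec.map (σ *ᴷ_) x , transpose x) singularValues
    (Vec.map (Vec.map fromℤᴷ) integral Vec.++
     Vec.map (combine (αᴷ *ᴷ αᴷ)) conjugate Vec.++
     Vec.map (combine (ᾱᴷ *ᴷ ᾱᴷ)) conjugate))
  where
  combine : K → Vec ℤ 12 × Vec ℤ 12 → Vec K 12
  combine σ² (a , b) = Vec.zipWith (λ aᵢ bᵢ → fromℤᴷ aᵢ +ᴷ σ² *ᴷ fromℤᴷ bᵢ) a b

  transpose : Vec K 12 → Vec K 12
  transpose x = tabulate λ l → ∑ᴷ (λ p → if incidence lines p l then lookup x p else 0ᴷ)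

  -- The two vectors made from one pair are orthogonal because its halves have equal squared length:
  -- |Nᵀ x|² = x · N Nᵀ x = σ² |x|².
  reflect : Vec (Vec K 12 × Vec K 12) 12 → Vec (Vec K 24) 24
  reflect xys =
    Vec.map (λ (x , y) → x Vec.++ y) xys Vec.++
    Vec.map (λ (x , y) → x Vec.++ Vec.map -ᴷ_ y) xys

module EigenvectorData where
  open import Agda.Builtin.FromNat using (Number; fromNat)
  open import Agda.Builtin.FromNeg using (Negative; fromNeg)
  private
    instance
      ℕ-number : Number ℕ
      ℕ-number = record { Constraint = λ _ → ⊤ ; fromNat = λ n → n }
      ℤ-number : Number ℤ
      ℤ-number = ℤ-Literals.number
      ℤ-negative : Negative ℤ
      ℤ-negative = ℤ-Literals.negative

  -- The i-th entry lists the lines through the point i.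
  linesG : Vec (List ℕ) 12
  linesG =
    (6 ∷ 9 ∷ 11 ∷ []) ∷ (0 ∷ 1 ∷ 4 ∷ []) ∷ (1 ∷ 2 ∷ 11 ∷ []) ∷ (0 ∷ 2 ∷ 3 ∷ []) ∷
    (1 ∷ 3 ∷ 10 ∷ []) ∷ (4 ∷ 5 ∷ 8 ∷ []) ∷ (3 ∷ 5 ∷ 6 ∷ []) ∷ (4 ∷ 6 ∷ 7 ∷ []) ∷
    (2 ∷ 5 ∷ 7 ∷ []) ∷ (0 ∷ 8 ∷ 9 ∷ []) ∷ (7 ∷ 9 ∷ 10 ∷ []) ∷ (8 ∷ 10 ∷ 11 ∷ []) ∷ []

  kernelG : Vec ℤ 12 × Vec ℤ 12
  kernelG =
    (-1 ∷ 0 ∷ 1 ∷ 0 ∷ -1 ∷ 0 ∷ 1 ∷ 0 ∷ -1 ∷ 0 ∷ 1 ∷ 0 ∷ []) ,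
    (0 ∷ 0 ∷ -1 ∷ 1 ∷ 0 ∷ 0 ∷ -1 ∷ 1 ∷ 0 ∷ 0 ∷ -1 ∷ 1 ∷ [])

  -- One row each for σ = 3, 2, 1, then an orthogonal basis of the four-dimensional eigenspace of N
  -- Nᵀ for σ² = 3.
  integralG : Vec (Vec ℤ 12) 7
  integralG =
    (1 ∷ 1 ∷ 1 ∷ 1 ∷ 1 ∷ 1 ∷ 1 ∷ 1 ∷ 1 ∷ 1 ∷ 1 ∷ 1 ∷ []) ∷
    (1 ∷ -2 ∷ 1 ∷ 0 ∷ 1 ∷ -2 ∷ 1 ∷ 0 ∷ 1 ∷ -2 ∷ 1 ∷ 0 ∷ []) ∷
    (-1 ∷ -1 ∷ -1 ∷ 3 ∷ -1 ∷ -1 ∷ -1 ∷ 3 ∷ -1 ∷ -1 ∷ -1 ∷ 3 ∷ []) ∷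
    (0 ∷ 0 ∷ 1 ∷ 0 ∷ -1 ∷ 0 ∷ -1 ∷ 0 ∷ 1 ∷ 0 ∷ 0 ∷ 0 ∷ []) ∷
    (2 ∷ 0 ∷ 1 ∷ 0 ∷ -1 ∷ 0 ∷ 1 ∷ 0 ∷ -1 ∷ 0 ∷ -2 ∷ 0 ∷ []) ∷
    (1 ∷ 0 ∷ -1 ∷ 2 ∷ -1 ∷ -2 ∷ 0 ∷ 0 ∷ 0 ∷ 2 ∷ 1 ∷ -2 ∷ []) ∷
    (1 ∷ 4 ∷ 1 ∷ -2 ∷ 1 ∷ -2 ∷ -2 ∷ 4 ∷ -2 ∷ -2 ∷ 1 ∷ -2 ∷ []) ∷
    []

  conjugateG : Vec (Vec ℤ 12 × Vec ℤ 12) 2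
  conjugateG =
    ((3 ∷ 2 ∷ -2 ∷ 3 ∷ -2 ∷ 3 ∷ -1 ∷ -3 ∷ -1 ∷ -5 ∷ 3 ∷ 0 ∷ []) ,
     (-1 ∷ 0 ∷ 1 ∷ 0 ∷ 1 ∷ -1 ∷ 0 ∷ 0 ∷ 0 ∷ 1 ∷ -1 ∷ 0 ∷ [])) ∷
    ((0 ∷ 2 ∷ -1 ∷ -1 ∷ -1 ∷ -2 ∷ 1 ∷ -1 ∷ 1 ∷ 0 ∷ 0 ∷ 2 ∷ []) ,
     (-1 ∷ 0 ∷ 0 ∷ 1 ∷ 0 ∷ 1 ∷ 1 ∷ 1 ∷ 1 ∷ -1 ∷ -1 ∷ -2 ∷ [])) ∷
    []

  linesH : Vec (List ℕ) 12
  linesH =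
    (6 ∷ 9 ∷ 11 ∷ []) ∷ (0 ∷ 1 ∷ 10 ∷ []) ∷ (1 ∷ 2 ∷ 11 ∷ []) ∷ (0 ∷ 2 ∷ 3 ∷ []) ∷
    (1 ∷ 3 ∷ 4 ∷ []) ∷ (4 ∷ 5 ∷ 8 ∷ []) ∷ (3 ∷ 5 ∷ 9 ∷ []) ∷ (4 ∷ 6 ∷ 7 ∷ []) ∷
    (2 ∷ 5 ∷ 7 ∷ []) ∷ (0 ∷ 6 ∷ 8 ∷ []) ∷ (7 ∷ 9 ∷ 10 ∷ []) ∷ (8 ∷ 10 ∷ 11 ∷ []) ∷ []

  kernelH : Vec ℤ 12 × Vec ℤ 12
  kernelH =
    (1 ∷ 0 ∷ -1 ∷ 0 ∷ 1 ∷ 0 ∷ -1 ∷ -1 ∷ 1 ∷ 0 ∷ 0 ∷ 0 ∷ []) ,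
    (1 ∷ 0 ∷ -1 ∷ 0 ∷ 0 ∷ 0 ∷ -1 ∷ 1 ∷ 0 ∷ 0 ∷ -1 ∷ 1 ∷ [])

  integralH : Vec (Vec ℤ 12) 7
  integralH =
    (1 ∷ 1 ∷ 1 ∷ 1 ∷ 1 ∷ 1 ∷ 1 ∷ 1 ∷ 1 ∷ 1 ∷ 1 ∷ 1 ∷ []) ∷
    (1 ∷ 0 ∷ 1 ∷ 0 ∷ -1 ∷ -2 ∷ 1 ∷ -1 ∷ 1 ∷ -2 ∷ 2 ∷ 0 ∷ []) ∷
    (-1 ∷ -3 ∷ -1 ∷ 3 ∷ 1 ∷ -1 ∷ -1 ∷ 1 ∷ -1 ∷ -1 ∷ 1 ∷ 3 ∷ []) ∷
    (1 ∷ -1 ∷ 1 ∷ 0 ∷ 0 ∷ 0 ∷ 0 ∷ 0 ∷ 0 ∷ 0 ∷ -1 ∷ 0 ∷ []) ∷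
    (1 ∷ 0 ∷ -1 ∷ 0 ∷ 1 ∷ 0 ∷ 2 ∷ -1 ∷ -2 ∷ 0 ∷ 0 ∷ 0 ∷ []) ∷
    (1 ∷ 0 ∷ -1 ∷ 2 ∷ -1 ∷ -2 ∷ 0 ∷ 1 ∷ 0 ∷ 2 ∷ 0 ∷ -2 ∷ []) ∷
    (1 ∷ 1 ∷ 1 ∷ -2 ∷ 4 ∷ -2 ∷ -2 ∷ 4 ∷ -2 ∷ -2 ∷ 1 ∷ -2 ∷ []) ∷
    []

  conjugateH : Vec (Vec ℤ 12 × Vec ℤ 12) 2
  conjugateH =
    ((3 ∷ 3 ∷ -2 ∷ 3 ∷ -3 ∷ 3 ∷ -1 ∷ 2 ∷ -1 ∷ -5 ∷ -2 ∷ 0 ∷ []) ,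
     (-1 ∷ 0 ∷ 1 ∷ 0 ∷ 1 ∷ -1 ∷ 0 ∷ -1 ∷ 0 ∷ 1 ∷ 0 ∷ 0 ∷ [])) ∷
    ((0 ∷ 1 ∷ -1 ∷ -1 ∷ 0 ∷ -2 ∷ 1 ∷ 1 ∷ 1 ∷ 0 ∷ -2 ∷ 2 ∷ []) ,
     (-1 ∷ -1 ∷ 0 ∷ 1 ∷ 1 ∷ 1 ∷ 1 ∷ 0 ∷ 1 ∷ -1 ∷ 0 ∷ -2 ∷ [])) ∷
    []

-- The two graphs

open EigenvectorData

graphG graphH : BipartiteGraph 24
graphG = leviGraph (incidence linesG)
graphH = leviGraph (incidence linesH)

regularG : Regular graphG 3
regularG = does-witness (Fin.all? λ u → degree graphG u ℕ.≟ 3) refl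

regularH : Regular graphH 3
regularH = does-witness (Fin.all? λ u → degree graphH u ℕ.≟ 3) refl

spectrumG : IsSpectrum graphG (λ k → eval (lookup eigenvalues k))
spectrumG = isSpectrum graphG eigenvalues
  (eigenvectors linesG kernelG integralG conjugateG) refl refl refl

spectrumH : IsSpectrum graphH (λ k → eval (lookup eigenvalues k))
spectrumH = isSpectrum graphH eigenvalues
  (eigenvectors linesH kernelH integralH conjugateH) refl refl refl

girthG : HasGirth graphG 6
girthG = (hexagon , refl , does-witness (isCycle? graphG hexagon) refl) ,
  cycles-≥6 graphG (does-witness (quadrilateral-free? graphG) refl)
  where
  -- Line l is the vertex 12 + l, so this is the triangle with points 0, 7, 10 and sides 6, 7, 9.
  -- These points lie on the same lines in both configurations.
  hexagon : List (Fin 24)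
  hexagon = # 0 ∷ # 18 ∷ # 7 ∷ # 19 ∷ # 10 ∷ # 21 ∷ []

girthH : HasGirth graphH 6
girthH = (hexagon , refl , does-witness (isCycle? graphH hexagon) refl) ,
  cycles-≥6 graphH (does-witness (quadrilateral-free? graphH) refl)
  where
  hexagon : List (Fin 24)
  hexagon = # 0 ∷ # 18 ∷ # 7 ∷ # 19 ∷ # 10 ∷ # 21 ∷ []

regular⇒biRegular : ∀ {n d} (G : BipartiteGraph n) → Regular G d → BiRegular G
regular⇒biRegular G regular u v _ = trans (regular u) (sym (regular v))

-- The sides of a Levi graph do not depend on the incidence relation, so the same vertices are
-- listed for both graphs and only their degrees have to be compared.
regular⇒sameDegreeSequences : ∀ {m d} (I J : Fin m → Fin m → Bool) →
  Regular (leviGraph I) d → Regular (leviGraph J) d → SameDegreeSequences (leviGraph I) (leviGraph J)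
regular⇒sameDegreeSequences I J regularI regularJ s =
  cong (Sort.sort (flipOrder ℕ.≤-decTotalOrder))
    (map-cong (λ u → trans (regularI u) (sym (regularJ u))) _)

-- The length i is kept a variable: comparing numCycles G 12 with
-- numCycles G (2 + 10) would make the type checker enumerate all 12-tuples.
numCycles-≢ : ∀ {n} (G H : BipartiteGraph n) i k → i ≡ suc (suc k) → ∀ {a b} →
  DepthFirst.cycleCount G k ≡ a → DepthFirst.cycleCount H k ≡ b → a ≢ b →
  numCycles G i ≢ numCycles H i
numCycles-≢ G H _ k refl G≡a H≡b a≢b G≡H = a≢b (trans
  (sym (trans (DepthFirst.numCycles≡cycleCount G k) G≡a))
  (trans G≡H (trans (DepthFirst.numCycles≡cycleCount H k) H≡b)))

-- Both graphs have literally the same Λ as spectrum, so even an `f` that separates equivalent or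
-- reordered spectra receives identical arguments.
¬determined : ∀ g i {n} (G H : BipartiteGraph n) → BiRegular G → BiRegular H → SameSpectrum G H →
  SameDegreeSequences G H → HasGirth G g → HasGirth H g →
  numCycles G i ≢ numCycles H i → ¬ DeterminedBySpectrumAndDegrees g i
¬determined g i G H biRegularG biRegularH (Λ , spectrumG , spectrumH) sameDegrees girthG girthH differ
  (f , determines) = differ (trans (determines G biRegularG girthG Λ spectrumG)
    (trans (cong₂ (f Λ) (sameDegrees true) (sameDegrees false))
           (sym (determines H biRegularH girthH Λ spectrumH))))

-- The lengths are i = 12 + 2j, and each pair of counts comes from running the depth-first search
-- for i - 2 further vertices. The last pair counts Hamiltonian cycles.
numCycles-≢-at : ∀ i j → i ≡ (6 ℕ.+ j) ℕ.* 2 → j ℕ.≤ 6 → numCycles graphG i ≢ numCycles graphH i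
numCycles-≢-at i 0 eq _ = numCycles-≢ graphG graphH i 10 eq {281}  {279}  refl refl λ ()
numCycles-≢-at i 1 eq _ = numCycles-≢ graphG graphH i 12 eq {588}  {602}  refl refl λ ()
numCycles-≢-at i 2 eq _ = numCycles-≢ graphG graphH i 14 eq {996}  {956}  refl refl λ ()
numCycles-≢-at i 3 eq _ = numCycles-≢ graphG graphH i 16 eq {1404} {1453} refl refl λ ()
numCycles-≢-at i 4 eq _ = numCycles-≢ graphG graphH i 18 eq {1332} {1285} refl refl λ ()
numCycles-≢-at i 5 eq _ = numCycles-≢ graphG graphH i 20 eq {600}  {640}  refl refl λ ()
numCycles-≢-at i 6 eq _ = numCycles-≢ graphG graphH i 22 eq {76}   {66}   refl refl λ ()
numCycles-≢-at i (suc (suc (suc (suc (suc (suc (suc _))))))) _ (s≤s (s≤s (s≤s (s≤s (s≤s (s≤s ()))))))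

open import Data.Nat.Base using (_*_; _≤_)
open import Data.Nat.Divisibility.Core using (_∣_)

numCycles-differ : ∀ i → 2 ∣ i → 2 * 6 ≤ i → i ≤ 24 → numCycles graphG i ≢ numCycles graphH i
numCycles-differ i (divides q i≡2q) 12≤i i≤24
  with ℕ.m≤n⇒∃[o]m+o≡n (ℕ.*-cancelʳ-≤ 6 q 2 (subst (12 ≤_) i≡2q 12≤i))
... | j , refl = numCycles-≢-at i j i≡2q
  (ℕ.+-cancelˡ-≤ 6 j 6 (ℕ.*-cancelʳ-≤ (6 ℕ.+ j) 12 2 (subst (_≤ 24) i≡2q i≤24)))

mainTheorem2 : ∃[ n ] Σ[ G ∈ BipartiteGraph n ] Σ[ H ∈ BipartiteGraph n ]
    ( (BiRegular G × BiRegular H)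
    × (Regular G 3 × Regular H 3)
    × SameSpectrum G H
    × SameDegreeSequences G H
    × (HasGirth G 6 × HasGirth H 6)
    × 2 * 6 ≤ n
    × (∀ i → 2 ∣ i → 2 * 6 ≤ i → i ≤ n → numCycles G i ≢ numCycles H i)
    × (∀ i → 2 ∣ i → 2 * 6 ≤ i → i ≤ n → ¬ DeterminedBySpectrumAndDegrees 6 i)
    )
mainTheorem2 =
  24 , graphG , graphH ,
  (biRegularG , biRegularH) ,
  (regularG , regularH) ,
  sameSpectrum ,
  sameDegreeSequences ,
  (girthG , girthH) ,
  -- This is 12 ≤ 24: the range of lengths in the last two claims is not empty.
  ℕ.m≤m+n 12 12 ,
  numCycles-differ ,
  λ i 2∣i 12≤i i≤24 → ¬determined 6 i graphG graphH biRegularG biRegularH sameSpectrum sameDegreeSequences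
    girthG girthH (numCycles-differ i 2∣i 12≤i i≤24)
  where
  biRegularG : BiRegular graphG
  biRegularG = regular⇒biRegular graphG regularG
  biRegularH : BiRegular graphH
  biRegularH = regular⇒biRegular graphH regularH
  sameSpectrum : SameSpectrum graphG graphH
  sameSpectrum = (λ k → eval (lookup eigenvalues k)) , spectrumG , spectrumH
  sameDegreeSequences : SameDegreeSequences graphG graphH
  sameDegreeSequences = regular⇒sameDegreeSequences (incidence linesG) (incidence linesH) regularG regularH
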